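{- The generating function $G_4(x)=\sum_{n\ge0}g_{4,n}x^n$ for Greek key tours on height $4$ grid graphs is $$G_4(x)=\frac{1-2x-2x^2+11x^3+4x^4-10x^5+4x^6+2x^7-3x^8+x^9}{(1-x-3x^2-x^3+x^4)(1-2x-2x^2+2x^3-x^4)}.$$
   Context: A Greek key tour on the $k\times n$ grid graph ($k$ rows, $n$ columns; vertices are integer points, edges join points at distance $1$) is a directed self-avoiding walk that starts at the upper-left corner vertex and visits every vertex of the grid exactly once. $g_{k,n}$ denotes the number of Greek key tours on the $k\times n$ grid graph, with the convention $g_{k,0}=1$. -}

module Defs where

open import Data.Empty using (⊥)
open import Data.Fin as Fin using (Fin; zero; suc; toℕ)
open import Data.Fin.Properties using (all?)
open import Data.Integer using (ℤ; +_; 0ℤ; 1ℤ; _+_; _-_; _*_; -_)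
import Data.Integer.Properties as ℤ
open import Data.List using
  (List; []; _∷_; length; filter; map; allFin; cartesianProduct; cartesianProductWith)
open import Data.List.Membership.Propositional using (_∈_)
import Data.List.Membership.DecPropositional as DecMembership
open import Data.List.Membership.Propositional.Properties using
  (∈-allFin; ∈-cartesianProduct⁺; ∈-cartesianProductWith⁺; ∈-filter⁺; ∈-filter⁻)
open import Data.List.Membership.Propositional.Properties.WithK using (unique∧set⇒bag)
open import Data.List.Properties using (length-++; length-map; length-tabulate)
open import Data.List.Relation.Binary.BagAndSetEquality using (∼bag⇒↭)
open import Data.List.Relation.Binary.Permutation.Propositional.Properties using (↭-length)
open import Data.List.Relation.Unary.All using ([])
open import Data.List.Relation.Unary.Any using (here)
open import Data.List.Relation.Unary.AllPairs using ([]; _∷_)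
open import Data.List.Relation.Unary.Linked using (Linked; linked?)
open import Data.List.Relation.Unary.Unique.Propositional using (Unique)
import Data.List.Relation.Unary.Unique.DecPropositional as DecUnique
import Data.List.Relation.Unary.Unique.Propositional.Properties as Unique
open import Data.Nat as ℕ using (ℕ; zero; suc; _∸_; ∣_-_∣)
open import Data.Product using (_×_; _,_; proj₁; proj₂; uncurry)
import Data.Product.Properties as ×
open import Function using (_∘_)
open import Function.Bundles using (_⇔_; mk⇔)
open import Relation.Binary.Definitions using (DecidableEquality)
open import Relation.Binary.PropositionalEquality
open import Relation.Nullary using (Dec; yes; no; _×-dec_)
open import Relation.Nullary.Decidable using (map′)
open import Algebra.Properties.Semiring.Sum ℤ.+-*-semiring using (sum⁺-syntax)

------------------------------------------------------------------------
-- Greek key tours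

-- Vertices are pairs (row , column), counted from the upper left.
Vertex : ℕ → ℕ → Set
Vertex k n = Fin k × Fin n

-- Taxicab distance; for integer points it equals 1 exactly when the
-- Euclidean distance does.
dist : ∀ {k n} → Vertex k n → Vertex k n → ℕ
dist (r , c) (r′ , c′) = ∣ toℕ r - toℕ r′ ∣ ℕ.+ ∣ toℕ c - toℕ c′ ∣

Adjacent : ∀ {k n} → Vertex k n → Vertex k n → Set
Adjacent u v = dist u v ≡ 1

StartsUpperLeft : ∀ {k n} → List (Vertex k n) → Set
StartsUpperLeft []            = ⊥
StartsUpperLeft ((r , c) ∷ _) = toℕ r ≡ 0 × toℕ c ≡ 0

VisitsAll : ∀ {k n} → List (Vertex k n) → Set
VisitsAll w = ∀ r c → (r , c) ∈ w

record IsTour {k n : ℕ} (w : List (Vertex k n)) : Set where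
  constructor isTour
  field
    start    : StartsUpperLeft w
    walk     : Linked Adjacent w
    avoiding : Unique w
    covering : VisitsAll w

_≟ᵥ_ : ∀ {k n} → DecidableEquality (Vertex k n)
_≟ᵥ_ = ×.≡-dec Fin._≟_ Fin._≟_

startsUpperLeft? : ∀ {k n} (w : List (Vertex k n)) → Dec (StartsUpperLeft w)
startsUpperLeft? []            = no λ ()
startsUpperLeft? ((r , c) ∷ _) = (toℕ r ℕ.≟ 0) ×-dec (toℕ c ℕ.≟ 0)

isTour? : ∀ {k n} (w : List (Vertex k n)) → Dec (IsTour w)
isTour? w = map′
  (λ (s , l , u , c) → isTour s l u c)
  (λ (isTour s l u c) → s , l , u , c)
  (startsUpperLeft? w
    ×-dec linked? (λ u v → dist u v ℕ.≟ 1) w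
    ×-dec DecUnique.unique? _≟ᵥ_ w
    ×-dec all? (λ r → all? (λ c → DecMembership._∈?_ _≟ᵥ_ (r , c) w)))

vertices : ∀ k n → List (Vertex k n)
vertices k n = cartesianProduct (allFin k) (allFin n)

-- All sequences of length m with entries from xs.
sequences : {A : Set} → List A → ℕ → List (List A)
sequences xs zero    = [] ∷ []
sequences xs (suc m) = cartesianProductWith _∷_ xs (sequences xs m)

-- A tour has exactly k * n vertices, so this lists every tour, each one
-- once: see ∈-tours and tours-unique.
tours : ∀ k n → List (List (Vertex k n))
tours k n = filter isTour? (sequences (vertices k n) (k ℕ.* n))

-- The empty grid has no corner to start from; g k 0 is 1 by convention.
g : ℕ → ℕ → ℕ
g k zero      = 1
g k n@(suc _) = length (tours k n)

∈-vertices : ∀ {k n} (v : Vertex k n) → v ∈ vertices k n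
∈-vertices (r , c) = ∈-cartesianProduct⁺ (∈-allFin r) (∈-allFin c)

vertices-unique : ∀ k n → Unique (vertices k n)
vertices-unique k n =
  Unique.cartesianProduct⁺ (Unique.allFin⁺ k) (Unique.allFin⁺ n)

length-cartesianProduct : {A B : Set} (xs : List A) (ys : List B) →
  length (cartesianProduct xs ys) ≡ length xs ℕ.* length ys
length-cartesianProduct []       ys = refl
length-cartesianProduct (x ∷ xs) ys = trans
  (length-++ (map (x ,_) ys))
  (cong₂ ℕ._+_ (length-map (x ,_) ys) (length-cartesianProduct xs ys))

length-vertices : ∀ k n → length (vertices k n) ≡ k ℕ.* n
length-vertices k n = trans
  (length-cartesianProduct (allFin k) (allFin n))
  (cong₂ ℕ._*_ (length-tabulate {n = k} (λ i → i)) (length-tabulate {n = n} (λ i → i)))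

length-tour : ∀ {k n} {w : List (Vertex k n)} → IsTour w → length w ≡ k ℕ.* n
length-tour {k} {n} {w} t = trans
  (↭-length (∼bag⇒↭ (unique∧set⇒bag (IsTour.avoiding t) (vertices-unique k n)
    (mk⇔ (λ _ → ∈-vertices _) (λ _ → IsTour.covering t _ _)))))
  (length-vertices k n)

∈-sequences : {A : Set} {xs : List A} → (∀ x → x ∈ xs) →
              ∀ w → w ∈ sequences xs (length w)
∈-sequences all []      = here refl
∈-sequences all (x ∷ w) = ∈-cartesianProductWith⁺ _∷_ (all x) (∈-sequences all w)

sequences-unique : {A : Set} {xs : List A} → Unique xs →
                   ∀ m → Unique (sequences xs m)
sequences-unique u zero    = [] ∷ []
sequences-unique u (suc m) =
  Unique.cartesianProductWith⁺ _∷_ (λ { refl → refl , refl }) u (sequences-unique u m)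

∈-tours : ∀ {k n} {w : List (Vertex k n)} → w ∈ tours k n ⇔ IsTour w
∈-tours {k} {n} {w} = mk⇔
  (λ w∈ → proj₂ (∈-filter⁻ isTour? {xs = sequences (vertices k n) (k ℕ.* n)} w∈))
  (λ t → ∈-filter⁺ isTour?
    (subst (λ m → w ∈ sequences (vertices k n) m) (length-tour t)
      (∈-sequences ∈-vertices w)) t)

tours-unique : ∀ k n → Unique (tours k n)
tours-unique k n =
  Unique.filter⁺ isTour? (sequences-unique (vertices-unique k n) (k ℕ.* n))

------------------------------------------------------------------------
-- Formal power series over ℤ, as coefficient sequences

PowerSeries : Set
PowerSeries = ℕ → ℤ

-- Polynomials, by their coefficients in order of increasing degree.
poly : List ℤ → PowerSeries
poly []       _       = 0ℤ
poly (a ∷ as) zero    = a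
poly (a ∷ as) (suc n) = poly as n

infixl 7 _⊛_
_⊛_ : PowerSeries → PowerSeries → PowerSeries
(P ⊛ Q) n = ∑[ i ≤ n ] (P (toℕ i) * Q (n ∸ toℕ i))

remainder : (P Q : PowerSeries) → PowerSeries
remainder P Q n = P (suc n) - P 0 * Q (suc n)

-- Long division by a series Q with constant term 1: the constant term of
-- the quotient is P 0, and the rest is the quotient of (P - P 0 · Q) / x
-- by Q.  By /-correct and /-unique this is the quotient in ℤ[[x]].
infix 6 _/_⟨_⟩
_/_⟨_⟩ : (P Q : PowerSeries) → .(Q 0 ≡ 1ℤ) → PowerSeries
(P / Q ⟨ Q₀ ⟩) zero    = P 0
(P / Q ⟨ Q₀ ⟩) (suc n) = (remainder P Q / Q ⟨ Q₀ ⟩) n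

private
  a+[b-a]≡b : ∀ a b → a + (b - a) ≡ b
  a+[b-a]≡b a b = begin
    a + (b - a)    ≡⟨ ℤ.+-comm a (b - a) ⟩
    b - a + a      ≡⟨ ℤ.+-assoc b (- a) a ⟩
    b + (- a + a)  ≡⟨ cong (λ z → b + z) (ℤ.+-inverseˡ a) ⟩
    b + 0ℤ         ≡⟨ ℤ.+-identityʳ b ⟩
    b              ∎
    where open ≡-Reasoning

  s≡[a+s]-a : ∀ a s → s ≡ a + s - a
  s≡[a+s]-a a s = sym (trans (ℤ.+-assoc a s (- a)) (a+[b-a]≡b a s))

  const-term : ∀ a {b} → b ≡ 1ℤ → a * b + 0ℤ ≡ a
  const-term a refl = trans (ℤ.+-identityʳ (a * 1ℤ)) (ℤ.*-identityʳ a)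

/-correct : ∀ P Q (Q₀ : Q 0 ≡ 1ℤ) → (P / Q ⟨ Q₀ ⟩) ⊛ Q ≗ P
/-correct P Q Q₀ zero    = const-term (P 0) Q₀
/-correct P Q Q₀ (suc n) =
  trans (cong (λ z → P 0 * Q (suc n) + z) (/-correct (remainder P Q) Q Q₀ n))
        (a+[b-a]≡b (P 0 * Q (suc n)) (P (suc n)))

/-unique : ∀ F P Q (Q₀ : Q 0 ≡ 1ℤ) → F ⊛ Q ≗ P → F ≗ P / Q ⟨ Q₀ ⟩
/-unique F P Q Q₀ eq zero    = trans (sym (const-term (F 0) Q₀)) (eq 0)
/-unique F P Q Q₀ eq (suc n) = /-unique (F ∘ suc) (remainder P Q) Q Q₀ eq′ n
  where
  F₀≡P₀ : F 0 ≡ P 0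
  F₀≡P₀ = trans (sym (const-term (F 0) Q₀)) (eq 0)

  eq′ : (F ∘ suc) ⊛ Q ≗ remainder P Q
  eq′ m = trans (s≡[a+s]-a (F 0 * Q (suc m)) (((F ∘ suc) ⊛ Q) m))
                (cong₂ (λ p q → p - q * Q (suc m)) (eq (suc m)) F₀≡P₀)

G : ℕ → PowerSeries
G k n = + g k n

{-# OPTIONS --safe #-}

-- Prolong a tour to a path from an artificial node S to an artificial node T,
-- where T can be entered from every vertex.  Deleting a vertex v from such a
-- path, between its neighbours p and q, leaves a path in a smaller graph that
-- has to take the step from p to q; recording p → q as an arc loses nothing.
-- Deleting a whole column this way leaves a grid with one column less and arcs
-- that only touch S, T and its first column.  Up to translation 69 sets of arcs
-- arise from the initial one, and their path counts are integer combinations of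
-- twelve of them, so the count of tours is a matrix coefficient u Mⁿ v.  The
-- denominator of the generating function is a polynomial relation for u Mⁿ.

module Submission where

open import Algebra.Properties.CommutativeSemigroup using (interchange)
open import Data.Bool using (if_then_else_)
open import Data.Empty using (⊥)
open import Data.Fin as Fin using (Fin; toℕ; #_)
open import Data.Fin.Patterns
import Data.Fin.Properties as Fin
open import Data.Integer using (+_; -_)
open import Data.Integer as ℤ using (ℤ; 0ℤ; 1ℤ)
import Data.Integer.Properties as ℤ
open import Data.List using ([]; _∷_)
open import Data.List using
  (List; _++_; map; foldr; filter; length; lookup; concatMap; cartesianProduct; allFin; findIndex)
import Data.List.Membership.DecPropositional as DecMembership
open import Data.List.Membership.Propositional using (_∈_; _∉_)
open import Data.List.Membership.Propositional.Properties using
  (∈-++⁺ˡ; ∈-++⁺ʳ; ∈-++⁻; ∈-map⁺; ∈-map⁻; ∈-filter⁺; ∈-filter⁻; ∈-allFin;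
   ∈-cartesianProduct⁺; ∈-cartesianProduct⁻)
open import Data.List.Membership.Propositional.Properties.WithK using (unique∧set⇒bag)
open import Data.List.Properties using
  (length-map; length-++; map-++; map-∘; map-injective; ∷ʳ-injectiveˡ; ∷-injectiveʳ)
open import Data.List.Relation.Binary.BagAndSetEquality using (∼bag⇒↭)
open import Data.List.Relation.Binary.Permutation.Propositional using
  (_↭_; ↭-refl; ↭-sym; ↭-trans; ↭⇒↭ₛ; prep; swap)
open import Data.List.Relation.Binary.Permutation.Propositional.Properties using
  (↭-length; ∈-resp-↭; ++-comm)
import Data.List.Relation.Binary.Permutation.Setoid.Properties as Perm
open import Data.List.Relation.Unary.All as All using (All; []; _∷_)
open import Data.List.Relation.Unary.AllPairs using ([]; _∷_)
open import Data.List.Relation.Unary.Any using (here; there)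
open import Data.List.Relation.Unary.Linked using (Linked; []; [-]; _∷_)
import Data.List.Relation.Unary.Unique.DecPropositional as DecUnique
open import Data.List.Relation.Unary.Unique.Propositional using (Unique)
import Data.List.Relation.Unary.Unique.Propositional.Properties as Unique
open import Data.Maybe using (fromMaybe)
open import Data.Nat as ℕ using (ℕ; zero; suc; ∣_-_∣)
open import Data.Nat.ListAction using (sum)
open import Data.Nat.ListAction.Properties using (sum-++)
import Data.Nat.Properties as ℕ
open import Data.Product using (∃; _×_; _,_; proj₁; proj₂)
import Data.Product.Properties as ×
open import Data.Sum using (_⊎_; inj₁; inj₂; [_,_]′)
open import Data.Unit using (⊤; tt)
open import Data.Vec as Vec using (Vec; []; _∷_)
import Data.Vec.Properties as Vec
open import Defs
open import Function using (_∘_; id; case_of_)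
open import Function.Bundles using (_⇔_; mk⇔; Equivalence)
open import Relation.Binary.Definitions using (DecidableEquality)
open import Relation.Binary.PropositionalEquality using (_≗_; refl)
open import Relation.Binary.PropositionalEquality using
  (_≡_; _≢_; sym; trans; cong; cong₂; subst; setoid; module ≡-Reasoning)
open import Relation.Nullary using
  (¬_; Dec; yes; no; does; ¬?; _×-dec_; _→-dec_; contradiction)
open import Relation.Nullary.Decidable using (True; map′; toWitness)

open Equivalence using (to; from)

-- An arc is enough memory because deletion can be undone in one way only: `p → q` says where `v`
-- goes back, and `p` and `q` are read off the longer path as the neighbours of `v`. Hence different
-- choices of neighbours give disjoint families of paths, and their counts add up. The arc has to be
-- compulsory and not merely allowed: `p → q` may also be an edge of the grid, and a path that does
-- not take this step leaves no place for `v`.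
--
-- The reduction from 69 states to twelve numbers uses no bijection between states of equal value.
-- It is a linear induction on the number of columns: the value of a state gives its count on zero
-- columns, and the values of its successors add up to its own value times `M`. Both facts are
-- finite checks on a table, settled by evaluation. What is left for proof is that the elimination
-- of a column is correct at every width.

private variable
  A B : Set

-- Lists without repetition

∉-head : ∀ {x : A} {l} → Unique (x ∷ l) → x ∉ l
∉-head (x≢ ∷ _) x∈ = All.lookup x≢ x∈ refl

∉⇒Unique : ∀ {x : A} {l} → x ∉ l → Unique l → Unique (x ∷ l)
∉⇒Unique x∉ u = All.tabulate (λ y∈ → λ { refl → x∉ y∈ }) ∷ u

Unique-tail : ∀ {x : A} {l} → Unique (x ∷ l) → Unique l
Unique-tail (_ ∷ u) = u

Unique-resp-↭ : ∀ {l m : List A} → l ↭ m → Unique l → Unique m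
Unique-resp-↭ l↭m = Perm.Unique-resp-↭ (setoid _) (↭⇒↭ₛ l↭m)

-- Counting

-- The witness is a list of all solutions, so `P` need not be decidable; `count-unique` makes the
-- number depend on `P` alone.
Count : (A → Set) → ℕ → Set
Count P n = ∃ λ xs → Unique xs × (∀ {x} → x ∈ xs ⇔ P x) × length xs ≡ n

count-unique : ∀ {P : A → Set} {m n} → Count P m → Count P n → m ≡ n
count-unique (xs , u , p , refl) (ys , v , q , refl) =
  ↭-length (∼bag⇒↭ (unique∧set⇒bag u v (mk⇔ (from q ∘ to p) (from p ∘ to q))))

count-cong : ∀ {P Q : A → Set} {n} → (∀ {x} → P x ⇔ Q x) → Count P n → Count Q n
count-cong e (xs , u , p , l) = xs , u , mk⇔ (to e ∘ to p) (from p ∘ from e) , l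

count-none : ∀ {P : A → Set} → (∀ {x} → ¬ P x) → Count P 0
count-none none = [] , [] , mk⇔ (λ ()) (λ p → contradiction p none) , refl

Image : (A → B) → (A → Set) → B → Set
Image f P y = ∃ λ x → P x × y ≡ f x

count-image : ∀ {P : A → Set} {n} (f : A → B) →
              (∀ {x y} → P x → P y → f x ≡ f y → x ≡ y) →
              Count P n → Count (Image f P) n
count-image {A = A} {B = B} {P = P} f inj (xs , u , p , refl) =
  map f xs , unique u (to p) ,
  mk⇔ (λ y∈ → let x , x∈ , e = ∈-map⁻ f y∈ in x , to p x∈ , e)
      (λ { (x , px , refl) → ∈-map⁺ f (from p px) }) ,
  length-map f xs
  where
  unique : ∀ {ys : List A} → Unique ys → (∀ {y} → y ∈ ys → P y) → Unique (map f ys)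
  unique [] all = []
  unique {y ∷ ys} uy all = ∉⇒Unique
    (λ fy∈ → let z , z∈ , e = ∈-map⁻ f fy∈
             in ∉-head uy (subst (_∈ ys) (sym (inj (all (here refl)) (all (there z∈)) e)) z∈))
    (unique (Unique-tail uy) (all ∘ there))

count-⋃ : ∀ {I : Set} {Q : I → A → Set} (is : List I) (n : I → ℕ) → Unique is →
          (∀ {i j x} → Q i x → Q j x → i ≡ j) →
          (∀ {i} → i ∈ is → Count (Q i) (n i)) →
          Count (λ x → ∃ λ i → i ∈ is × Q i x) (sum (map n is))
count-⋃ [] n u d c = count-none λ ()
count-⋃ {Q = Q} (i ∷ is) n u d c
  with xs , ux , p , e′ ← c (here refl)
     | ys , uy , q , e ← count-⋃ is n (Unique-tail u) d (c ∘ there) =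
  xs ++ ys ,
  Unique.++⁺ ux uy (λ (x∈ , y∈) → let j , j∈ , qj = to q y∈ in
    ∉-head u (subst (_∈ is) (sym (d (to p x∈) qj)) j∈)) ,
  mk⇔ (λ x∈ → case ∈-++⁻ xs x∈ of λ where
         (inj₁ a) → i , here refl , to p a
         (inj₂ b) → let j , j∈ , qj = to q b in j , there j∈ , qj)
      (λ { (_ , here refl , qi) → ∈-++⁺ˡ (from p qi)
         ; (j , there j∈ , qj) → ∈-++⁺ʳ xs (from q (j , j∈ , qj)) }) ,
  trans (length-++ xs) (cong₂ ℕ._+_ e′ e)

-- Consecutive entries of a list

data Next {A : Set} : List A → A → A → Set where
  here  : ∀ {x y l} → Next (x ∷ y ∷ l) x y
  there : ∀ {x y z l} → Next l x y → Next (z ∷ l) x y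

next-target : ∀ {z : A} {l x y} → Next (z ∷ l) x y → y ∈ l
next-target here = here refl
next-target {l = _ ∷ _} (there n) = there (next-target n)

next-source : ∀ {l : List A} {x y} → Next l x y → x ∈ l
next-source here = here refl
next-source (there n) = there (next-source n)

next-target∈ : ∀ {l : List A} {x y} → Next l x y → y ∈ l
next-target∈ {l = _ ∷ _} n = there (next-target n)

next-irrefl : ∀ {l : List A} {x y} → Unique l → Next l x y → x ≢ y
next-irrefl u here refl = ∉-head u (here refl)
next-irrefl u (there n) = next-irrefl (Unique-tail u) n

next-functional : ∀ {l : List A} {x y z} → Unique l → Next l x y → Next l x z → y ≡ z
next-functional u here here = refl
next-functional u here (there n) = contradiction (next-source n) (∉-head u)
next-functional u (there m) here = contradiction (next-source m) (∉-head u)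
next-functional u (there m) (there n) = next-functional (Unique-tail u) m n

next-injective : ∀ {l : List A} {x y z} → Unique l → Next l x z → Next l y z → x ≡ y
next-injective u here here = refl
next-injective (_ ∷ u) here (there n) = contradiction (next-target n) (∉-head u)
next-injective (_ ∷ u) (there n) here = contradiction (next-target n) (∉-head u)
next-injective u (there m) (there n) = next-injective (Unique-tail u) m n

-- Only the last entry can lack a successor. Applied with `T`, which nothing follows, this gives
-- every other node of a path a successor.
successor : ∀ {l : List A} {x y} → x ∈ l → y ∈ l → x ≢ y → (∃ (Next l x)) ⊎ (∃ (Next l y))
successor {l = _ ∷ []} (here refl) (here refl) x≢y = contradiction refl x≢y
successor {l = _ ∷ _ ∷ _} (here refl) _ _ = inj₁ (_ , here)
successor {l = _ ∷ _ ∷ _} (there _) (here refl) _ = inj₂ (_ , here)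
successor (there x∈) (there y∈) x≢y with successor x∈ y∈ x≢y
... | inj₁ (z , n) = inj₁ (z , there n)
... | inj₂ (z , n) = inj₂ (z , there n)

predecessor-in-tail : ∀ {z : A} {l x} → x ∈ l → ∃ λ y → Next (z ∷ l) y x
predecessor-in-tail (here refl) = _ , here
predecessor-in-tail (there x∈) = let y , n = predecessor-in-tail x∈ in y , there n

predecessor : ∀ {l : List A} {x y} → x ∈ l → y ∈ l → x ≢ y →
              (∃ λ z → Next l z x) ⊎ (∃ λ z → Next l z y)
predecessor (here refl) (here refl) x≢y = contradiction refl x≢y
predecessor (there x∈) _ _ = inj₁ (predecessor-in-tail x∈)
predecessor (here refl) (there y∈) _ = inj₂ (predecessor-in-tail y∈)

next-map⁺ : ∀ (f : A → B) {l x y} → Next l x y → Next (map f l) (f x) (f y)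
next-map⁺ f here = here
next-map⁺ f (there n) = there (next-map⁺ f n)

next-map⁻ : ∀ (f : A → B) {l x y} → Next (map f l) x y →
            ∃ λ a → ∃ λ b → Next l a b × x ≡ f a × y ≡ f b
next-map⁻ f {_ ∷ _ ∷ _} here = _ , _ , here , refl , refl
next-map⁻ f {_ ∷ _} (there n) =
  let a , b , m , e , e′ = next-map⁻ f n in a , b , there m , e , e′

next-map-injective : ∀ (f : A → B) → (∀ {x y} → f x ≡ f y → x ≡ y) →
                     ∀ {l x y} → Next (map f l) (f x) (f y) → Next l x y
next-map-injective f inj n with a , b , m , e , e′ ← next-map⁻ f n
  with refl ← inj e | refl ← inj e′ = m

-- Insertion between consecutive entries

-- A relation, because it is read both as insertion of `v` into the first list and as its deletion
-- from the second.
data Insert {A : Set} (p v q : A) : List A → List A → Set where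
  here  : ∀ {l} → Insert p v q (p ∷ q ∷ l) (p ∷ v ∷ q ∷ l)
  there : ∀ {x l m} → Insert p v q l m → Insert p v q (x ∷ l) (x ∷ m)

module _ {A : Set} {p v q : A} where

  insert-↭ : ∀ {l m} → Insert p v q l m → m ↭ v ∷ l
  insert-↭ here = swap p v ↭-refl
  insert-↭ (there {x} i) = ↭-trans (prep x (insert-↭ i)) (swap x v ↭-refl)

  insert-next : ∀ {l m x y} → Insert p v q l m → Next m x y →
                Next l x y ⊎ (x ≡ p × y ≡ v) ⊎ (x ≡ v × y ≡ q)
  insert-next here here = inj₂ (inj₁ (refl , refl))
  insert-next here (there here) = inj₂ (inj₂ (refl , refl))
  insert-next here (there (there n)) = inj₁ (there n)
  insert-next (there here) here = inj₁ here
  insert-next (there (there i)) here = inj₁ here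
  insert-next (there i) (there n) with insert-next i n
  ... | inj₁ n′ = inj₁ (there n′)
  ... | inj₂ e  = inj₂ e

  insert-next⁻ : ∀ {l m x y} → Insert p v q l m → Next l x y → Next m x y ⊎ (x ≡ p × y ≡ q)
  insert-next⁻ here here = inj₂ (refl , refl)
  insert-next⁻ here (there n) = inj₁ (there (there n))
  insert-next⁻ (there here) here = inj₁ here
  insert-next⁻ (there (there i)) here = inj₁ here
  insert-next⁻ (there i) (there n) with insert-next⁻ i n
  ... | inj₁ n′ = inj₁ (there n′)
  ... | inj₂ e  = inj₂ e

  insert-pv : ∀ {l m} → Insert p v q l m → Next m p v
  insert-pv here = here
  insert-pv (there i) = there (insert-pv i)

  insert-vq : ∀ {l m} → Insert p v q l m → Next m v q
  insert-vq here = there here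
  insert-vq (there i) = there (insert-vq i)

  insert-pq : ∀ {l m} → Insert p v q l m → Next l p q
  insert-pq here = here
  insert-pq (there i) = there (insert-pq i)

  remove : ∀ {m} → Unique m → Next m p v → Next m v q → ∃ λ l → Insert p v q l m
  remove u here here = contradiction (here refl) (∉-head u)
  remove u here (there here) = _ , here
  remove (_ ∷ u) here (there (there n)) = contradiction (next-source n) (∉-head u)
  remove u (there n) here = contradiction (next-target∈ n) (∉-head u)
  remove u (there n) (there n′) =
    let l , i = remove (Unique-tail u) n n′ in _ , there i

insert-injective : ∀ {p v q : A} {l l′ m} → v ∉ l → v ∉ l′ →
                   Insert p v q l m → Insert p v q l′ m → l ≡ l′
insert-injective v∉l v∉l′ here here = refl
insert-injective v∉l v∉l′ here (there here) = contradiction (here refl) v∉l′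
insert-injective v∉l v∉l′ here (there (there i)) = contradiction (there (here refl)) v∉l′
insert-injective v∉l v∉l′ (there here) here = contradiction (here refl) v∉l
insert-injective v∉l v∉l′ (there (there i)) here = contradiction (there (here refl)) v∉l
insert-injective v∉l v∉l′ (there i) (there j) =
  cong (_ ∷_) (insert-injective (v∉l ∘ there) (v∉l′ ∘ there) i j)

module Insertion {A : Set} (_≟_ : DecidableEquality A) where

  insertAfter : A → A → List A → List A
  insertAfter p v [] = []
  insertAfter p v (x ∷ l) with x ≟ p
  ... | yes _ = x ∷ v ∷ l
  ... | no  _ = x ∷ insertAfter p v l

  insertAfter-insert : ∀ {p v q l} → Unique l → Next l p q → Insert p v q l (insertAfter p v l)
  insertAfter-insert {p} u here with p ≟ p
  ... | yes _ = here
  ... | no p≢p = contradiction refl p≢p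
  insertAfter-insert {p} u (there {z = z} n) with z ≟ p
  ... | yes refl = contradiction (next-source n) (∉-head u)
  ... | no _ = there (insertAfter-insert (Unique-tail u) n)

  insert-insertAfter : ∀ {p v q l m} → Unique l → Insert p v q l m → m ≡ insertAfter p v l
  insert-insertAfter {p} u here with p ≟ p
  ... | yes _ = refl
  ... | no p≢p = contradiction refl p≢p
  insert-insertAfter {p} u (there {x} i) with x ≟ p
  ... | yes refl = contradiction (next-source (insert-pq i)) (∉-head u)
  ... | no _ = cong (x ∷_) (insert-insertAfter (Unique-tail u) i)

-- Walks through required arcs

module Walks {Node : Set} (_≟_ : DecidableEquality Node) (S T : Node) (E : Node → Node → Set) where

  open Insertion _≟_

  Arcs : Set
  Arcs = List (Node × Node)

  -- `from-S` and `to-T` fix both ends without splitting the list, a form that is easy to carry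
  -- through insertions and deletions at any place.
  record Path (arcs : Arcs) (vs l : List Node) : Set where
    field
      unique   : Unique l
      visits   : ∀ {x} → x ∈ l ⇔ x ∈ S ∷ T ∷ vs
      from-S   : ∀ {x} → ¬ Next l x S
      to-T     : ∀ {x} → ¬ Next l T x
      steps    : ∀ {x y} → Next l x y → E x y ⊎ (x , y) ∈ arcs
      required : ∀ {x y} → (x , y) ∈ arcs → Next l x y

  open Path

  without : Node → Arcs → Arcs
  without v = filter (λ (x , y) → ¬? (x ≟ v) ×-dec ¬? (y ≟ v))

  -- An arc at v determines the neighbour of v on that side.  Only the first such arc is
  -- looked at here; Fits rejects the choice if another one disagrees.
  sources : List Node → Node → Arcs → List Node
  sources ns v [] = ns
  sources ns v ((x , y) ∷ arcs) with y ≟ v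
  ... | yes _ = x ∷ []
  ... | no  _ = sources ns v arcs

  targets : List Node → Node → Arcs → List Node
  targets ns v [] = ns
  targets ns v ((x , y) ∷ arcs) with x ≟ v
  ... | yes _ = y ∷ []
  ... | no  _ = targets ns v arcs

  -- A node has one successor and one predecessor in a path, so an arc that shares its source or its
  -- target with `p → v` or `v → q` must be that step.
  Compatible : Node → Node × Node → Node × Node → Set
  Compatible v (p , q) (x , y) =
    (x ≡ p → y ≡ v) × (y ≡ q → x ≡ v) × (y ≡ v → x ≡ p) × (x ≡ v → y ≡ q)

  -- With `p ≡ q` the steps `p → v → q` would close a cycle.
  Fits : Node → Arcs → Node × Node → Set
  Fits v arcs (p , q) = p ≢ q × All (Compatible v (p , q)) arcs

  fits? : ∀ v arcs e → Dec (Fits v arcs e)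
  fits? v arcs (p , q) = ¬? (p ≟ q) ×-dec All.all? (λ (x , y) →
    ((x ≟ p) →-dec (y ≟ v)) ×-dec ((y ≟ q) →-dec (x ≟ v)) ×-dec
    ((y ≟ v) →-dec (x ≟ p)) ×-dec ((x ≟ v) →-dec (y ≟ q))) arcs

  sources-complete : ∀ {ns v p} arcs → (∀ {x} → (x , v) ∈ arcs → x ≡ p) →
                     p ∈ ns ⊎ (p , v) ∈ arcs → p ∈ sources ns v arcs
  sources-complete [] _ (inj₁ p∈) = p∈
  sources-complete {v = v} ((x , y) ∷ arcs) only p∈ with y ≟ v
  ... | yes refl = here (sym (only (here refl)))
  sources-complete (_ ∷ arcs) only (inj₁ p∈) | no _ =
    sources-complete arcs (only ∘ there) (inj₁ p∈)
  sources-complete (_ ∷ arcs) only (inj₂ (here refl)) | no y≢v = contradiction refl y≢v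
  sources-complete (_ ∷ arcs) only (inj₂ (there e∈)) | no _ =
    sources-complete arcs (only ∘ there) (inj₂ e∈)

  targets-complete : ∀ {ns v q} arcs → (∀ {y} → (v , y) ∈ arcs → y ≡ q) →
                     q ∈ ns ⊎ (v , q) ∈ arcs → q ∈ targets ns v arcs
  targets-complete [] _ (inj₁ q∈) = q∈
  targets-complete {v = v} ((x , y) ∷ arcs) only q∈ with x ≟ v
  ... | yes refl = here (sym (only (here refl)))
  targets-complete (_ ∷ arcs) only (inj₁ q∈) | no _ =
    targets-complete arcs (only ∘ there) (inj₁ q∈)
  targets-complete (_ ∷ arcs) only (inj₂ (here refl)) | no x≢v = contradiction refl x≢v
  targets-complete (_ ∷ arcs) only (inj₂ (there e∈)) | no _ =
    targets-complete arcs (only ∘ there) (inj₂ e∈)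

  sources-sound : ∀ {ns v p} arcs → p ∈ sources ns v arcs → p ∈ ns ⊎ (p , v) ∈ arcs
  sources-sound [] p∈ = inj₁ p∈
  sources-sound {v = v} ((x , y) ∷ arcs) p∈ with y ≟ v
  sources-sound (_ ∷ arcs) (here refl) | yes refl = inj₂ (here refl)
  ... | no _ with sources-sound arcs p∈
  ...   | inj₁ p∈′ = inj₁ p∈′
  ...   | inj₂ e∈  = inj₂ (there e∈)

  targets-sound : ∀ {ns v q} arcs → q ∈ targets ns v arcs → q ∈ ns ⊎ (v , q) ∈ arcs
  targets-sound [] q∈ = inj₁ q∈
  targets-sound {v = v} ((x , y) ∷ arcs) q∈ with x ≟ v
  targets-sound (_ ∷ arcs) (here refl) | yes refl = inj₂ (here refl)
  ... | no _ with targets-sound arcs q∈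
  ...   | inj₁ q∈′ = inj₁ q∈′
  ...   | inj₂ e∈  = inj₂ (there e∈)

  sources-unique : ∀ {ns v} arcs → Unique ns → Unique (sources ns v arcs)
  sources-unique [] u = u
  sources-unique {v = v} ((x , y) ∷ arcs) u with y ≟ v
  ... | yes _ = [] ∷ []
  ... | no  _ = sources-unique arcs u

  targets-unique : ∀ {ns v} arcs → Unique ns → Unique (targets ns v arcs)
  targets-unique [] u = u
  targets-unique {v = v} ((x , y) ∷ arcs) u with x ≟ v
  ... | yes _ = [] ∷ []
  ... | no  _ = targets-unique arcs u

  without-∈⁺ : ∀ {v x y arcs} → (x , y) ∈ arcs → x ≢ v → y ≢ v → (x , y) ∈ without v arcs
  without-∈⁺ e∈ x≢v y≢v = ∈-filter⁺ _ e∈ (x≢v , y≢v)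

  without-∈⁻ : ∀ {v e} arcs → e ∈ without v arcs → e ∈ arcs × proj₁ e ≢ v × proj₂ e ≢ v
  without-∈⁻ arcs = ∈-filter⁻ _ {xs = arcs}

  -- Elimination of one node

  record Star : Set where
    constructor star
    field
      centre   : Node
      incoming : List Node
      outgoing : List Node
  open Star

  choices : Star → Arcs → Arcs
  choices (star v is os) arcs =
    filter (fits? v arcs) (cartesianProduct (sources is v arcs) (targets os v arcs))

  eliminate : Star → Arcs → List Arcs
  eliminate v arcs = map (_∷ without (centre v) arcs) (choices v arcs)

  -- Completeness of the two lists is asked only for nodes still present, and the lists may name
  -- others. A choice with an absent neighbour creates a compulsory arc at a node that no path
  -- visits, so it contributes zero.
  record Exposed (v : Star) (vs : List Node) : Set where
    field
      fresh            : centre v ∉ S ∷ T ∷ vs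
      incoming-unique  : Unique (incoming v)
      outgoing-unique  : Unique (outgoing v)
      incoming⁺ : ∀ {x} → x ∈ S ∷ T ∷ vs → E x (centre v) → x ∈ incoming v
      incoming⁻ : ∀ {x} → x ∈ incoming v → E x (centre v)
      outgoing⁺ : ∀ {x} → x ∈ S ∷ T ∷ vs → E (centre v) x → x ∈ outgoing v
      outgoing⁻ : ∀ {x} → x ∈ outgoing v → E (centre v) x
  open Exposed

  private
    swap₃ : ∀ {x y z w : Node} {l} → w ∈ x ∷ y ∷ z ∷ l → w ∈ z ∷ x ∷ y ∷ l
    swap₃ (here refl) = there (here refl)
    swap₃ (there (here refl)) = there (there (here refl))
    swap₃ (there (there (here refl))) = here refl
    swap₃ (there (there (there w∈))) = there (there (there w∈))

    swap₃⁻ : ∀ {x y z w : Node} {l} → w ∈ z ∷ x ∷ y ∷ l → w ∈ x ∷ y ∷ z ∷ l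
    swap₃⁻ (here refl) = there (there (here refl))
    swap₃⁻ (there (here refl)) = here refl
    swap₃⁻ (there (there (here refl))) = there (here refl)
    swap₃⁻ (there (there (there w∈))) = there (there (there w∈))

  module _ {v : Node} {is os vs : List Node} {arcs : Arcs} (ex : Exposed (star v is os) vs) where

    Reduced : Node × Node → List Node → Set
    Reduced e = Path (e ∷ without v arcs) vs

    Extended : Node × Node → List Node → Set
    Extended e = Image (insertAfter (proj₁ e) v) (Reduced e)

    reduced-fresh : ∀ {e l} → Reduced e l → v ∉ l
    reduced-fresh r v∈ = fresh ex (to (visits r) v∈)

    extended-insert : ∀ {e m} → Extended e m →
                      ∃ λ l → Reduced e l × Insert (proj₁ e) v (proj₂ e) l m
    extended-insert (l , r , refl) =
      l , r , insertAfter-insert (unique r) (required r (here refl))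

    insert-unique : ∀ {p q l m} → v ∉ l → Unique l → Insert p v q l m → Unique m
    insert-unique v∉ u i = Unique-resp-↭ (↭-sym (insert-↭ i)) (∉⇒Unique v∉ u)

    -- `p` and `q` are recovered from `m` as the neighbours of `v`.
    extended-disjoint : ∀ {e e′ m} → Extended e m → Extended e′ m → e ≡ e′
    extended-disjoint x x′
      with l , r , i ← extended-insert x | _ , _ , i′ ← extended-insert x′ =
      cong₂ _,_ (next-injective u (insert-pv i) (insert-pv i′))
                (next-functional u (insert-vq i) (insert-vq i′))
      where u = insert-unique (reduced-fresh r) (unique r) i

    extend-injective : ∀ {e l l′} → Reduced e l → Reduced e l′ →
      insertAfter (proj₁ e) v l ≡ insertAfter (proj₁ e) v l′ → l ≡ l′
    extend-injective {p , q} r r′ eq = insert-injective {q = q} (reduced-fresh r) (reduced-fresh r′)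
      (insertAfter-insert (unique r) (required r (here refl)))
      (subst (Insert _ _ _ _) (sym eq) (insertAfter-insert (unique r′) (required r′ (here refl))))

    extend : ∀ {e m} → e ∈ choices (star v is os) arcs → Extended e m → Path arcs (v ∷ vs) m
    extend {p , q} {m} e∈ x
      with l , r , i ← extended-insert x
         | prod∈ , p≢q , fits ← ∈-filter⁻ (fits? v arcs)
             {xs = cartesianProduct (sources is v arcs) (targets os v arcs)} e∈
      with p∈ , q∈ ← ∈-cartesianProduct⁻ (sources is v arcs) (targets os v arcs) prod∈ = record
      { unique = insert-unique (reduced-fresh r) (unique r) i
      ; visits = mk⇔ (λ x∈ → swap₃⁻ (extend-visit (∈-resp-↭ (insert-↭ i) x∈)))
                     (λ x∈ → ∈-resp-↭ (↭-sym (insert-↭ i)) (restrict-visit (swap₃ x∈)))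
      ; from-S = λ n → case insert-next i n of λ where
          (inj₁ n′) → from-S r n′
          (inj₂ (inj₁ (refl , refl))) → fresh ex (here refl)
          (inj₂ (inj₂ (refl , refl))) → from-S r (insert-pq i)
      ; to-T = λ n → case insert-next i n of λ where
          (inj₁ n′) → to-T r n′
          (inj₂ (inj₁ (refl , refl))) → to-T r (insert-pq i)
          (inj₂ (inj₂ (refl , refl))) → fresh ex (there (here refl))
      ; steps = λ n → case insert-next i n of λ where
          (inj₂ (inj₁ (refl , refl))) → [ inj₁ ∘ incoming⁻ ex , inj₂ ]′ (sources-sound arcs p∈)
          (inj₂ (inj₂ (refl , refl))) → [ inj₁ ∘ outgoing⁻ ex , inj₂ ]′ (targets-sound arcs q∈)
          (inj₁ n′) → case steps r n′ of λ where
            (inj₁ edge) → inj₁ edge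
            (inj₂ (there e∈)) → inj₂ (proj₁ (without-∈⁻ arcs e∈))
            -- The new arc never has to justify a step of `m`, where `p` is followed by `v`.
            (inj₂ (here refl)) → contradiction refl (no-pq n)
      ; required = λ {x} {y} e∈ → let (px , qy , vy , vx) = All.lookup fits e∈ in
          case (x ≟ v) , (y ≟ v) of λ where
            (yes refl , _) → subst (Next m v) (sym (vx refl)) (insert-vq i)
            (no _ , yes refl) → subst (λ z → Next m z v) (sym (vy refl)) (insert-pv i)
            (no x≢v , no y≢v) → case insert-next⁻ i (required r (there (without-∈⁺ e∈ x≢v y≢v))) of λ where
              (inj₁ n) → n
              -- Were `p → q` itself an old arc, `l` could satisfy the old and the new one with a
              -- single step while `m` breaks the old one. `Fits` has discarded that choice.
              (inj₂ (x≡p , _)) → contradiction (px x≡p) y≢v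
      }
      where
      extend-visit : ∀ {x} → x ∈ v ∷ l → x ∈ v ∷ S ∷ T ∷ vs
      extend-visit (here e) = here e
      extend-visit (there x∈) = there (to (visits r) x∈)

      restrict-visit : ∀ {x} → x ∈ v ∷ S ∷ T ∷ vs → x ∈ v ∷ l
      restrict-visit (here e) = here e
      restrict-visit (there x∈) = there (from (visits r) x∈)

      no-pq : ∀ {x y} → Next m x y → (x , y) ≢ (p , q)
      no-pq n refl = reduced-fresh r (subst (_∈ l)
        (sym (next-functional (insert-unique (reduced-fresh r) (unique r) i) (insert-pv i) n))
        (next-target∈ (insert-pq i)))

    has-predecessor : ∀ {m} → Path arcs (v ∷ vs) m → ∃ λ p → Next m p v
    has-predecessor π
      with predecessor (from (visits π) (there (there (here refl)))) (from (visits π) (here refl))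
                       (λ e → fresh ex (here e))
    ... | inj₁ n = n
    ... | inj₂ (_ , n) = contradiction n (from-S π)

    has-successor : ∀ {m} → Path arcs (v ∷ vs) m → ∃ λ q → Next m v q
    has-successor π
      with successor (from (visits π) (there (there (here refl)))) (from (visits π) (there (here refl)))
                     (λ e → fresh ex (there (here e)))
    ... | inj₁ n = n
    ... | inj₂ (_ , n) = contradiction n (to-T π)

    -- `v` is neither `S` nor `T`, so it stands between some `p` and `q`. The choice `(p , q)` fits
    -- because `m` takes all old arcs and each node has at most one neighbour on each side.
    restrict : ∀ {m} → Path arcs (v ∷ vs) m →
               ∃ λ e → e ∈ choices (star v is os) arcs × Extended e m
    restrict {m} π
      with p , pv ← has-predecessor π | q , vq ← has-successor π
      with l , i ← remove (unique π) pv vq =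
      (p , q) ,
      ∈-filter⁺ (fits? v arcs)
        (∈-cartesianProduct⁺
          (sources-complete arcs (λ e∈ → next-injective (unique π) (required π e∈) pv)
            ([ inj₁ ∘ incoming⁺ ex (old (next-source pv) (next-irrefl (unique π) pv)) , inj₂ ]′ (steps π pv)))
          (targets-complete arcs (λ e∈ → next-functional (unique π) (required π e∈) vq)
            ([ inj₁ ∘ outgoing⁺ ex (old (next-target∈ vq) (next-irrefl (unique π) vq ∘ sym)) , inj₂ ]′ (steps π vq))))
        ( next-irrefl l-unique (insert-pq i)
        , All.tabulate (λ e∈ → let n = required π e∈ in
            (λ { refl → next-functional (unique π) n pv }) ,
            (λ { refl → next-injective (unique π) n vq }) ,
            (λ { refl → next-injective (unique π) n pv }) ,
            (λ { refl → next-functional (unique π) n vq }))) ,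
      l ,
      record
        { unique = l-unique
        ; visits = mk⇔
            (λ x∈ → old (∈-resp-↭ (↭-sym (insert-↭ i)) (there x∈)) λ { refl → v∉l x∈ })
            (λ x∈ → kept (from (visits π) (swap₃⁻ (there x∈))) λ { refl → fresh ex x∈ })
        ; from-S = λ n → case insert-next⁻ i n of λ where
            (inj₁ n′) → from-S π n′
            (inj₂ (refl , refl)) → from-S π vq
        ; to-T = λ n → case insert-next⁻ i n of λ where
            (inj₁ n′) → to-T π n′
            (inj₂ (refl , refl)) → to-T π pv
        ; steps = λ n → case insert-next⁻ i n of λ where
            (inj₂ (refl , refl)) → inj₂ (here refl)
            (inj₁ n′) → case steps π n′ of λ where
              (inj₁ edge) → inj₁ edge
              (inj₂ e∈) → inj₂ (there (without-∈⁺ e∈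
                (λ { refl → v∉l (next-source n) }) (λ { refl → v∉l (next-target∈ n) })))
        ; required = λ where
            (here refl) → insert-pq i
            (there e∈) → let e∈′ , x≢v , y≢v = without-∈⁻ arcs e∈ in
              case insert-next i (required π e∈′) of λ where
                (inj₁ n) → n
                (inj₂ (inj₁ (_ , y≡v))) → contradiction y≡v y≢v
                (inj₂ (inj₂ (x≡v , _))) → contradiction x≡v x≢v
        } ,
      insert-insertAfter l-unique i
      where
      vl-unique : Unique (v ∷ l)
      vl-unique = Unique-resp-↭ (insert-↭ i) (unique π)

      l-unique : Unique l
      l-unique = Unique-tail vl-unique

      v∉l : v ∉ l
      v∉l = ∉-head vl-unique

      old : ∀ {x} → x ∈ m → x ≢ v → x ∈ S ∷ T ∷ vs
      old x∈ x≢v with swap₃ (to (visits π) x∈)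
      ... | here x≡v = contradiction x≡v x≢v
      ... | there x∈′ = x∈′

      kept : ∀ {x} → x ∈ m → x ≢ v → x ∈ l
      kept x∈ x≢v with ∈-resp-↭ (insert-↭ i) x∈
      ... | here x≡v = contradiction x≡v x≢v
      ... | there x∈′ = x∈′

    count-eliminate : (n : Arcs → ℕ) →
      (∀ {a} → a ∈ eliminate (star v is os) arcs → Count (Path a vs) (n a)) →
      Count (Path arcs (v ∷ vs)) (sum (map n (eliminate (star v is os) arcs)))
    count-eliminate n c = subst (Count _)
      (cong sum (map-∘ (choices (star v is os) arcs)))
      (count-cong (mk⇔ (λ (e , e∈ , x) → extend e∈ x) restrict)
        (count-⋃ (choices (star v is os) arcs) (n ∘ (_∷ without v arcs))
          (Unique.filter⁺ (fits? v arcs) (Unique.cartesianProduct⁺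
            (sources-unique arcs (incoming-unique ex)) (targets-unique arcs (outgoing-unique ex))))
          extended-disjoint
          (λ e∈ → count-image _ extend-injective (c (∈-map⁺ _ e∈)))))

  -- Elimination of several nodes in turn

  eliminateAll : List Star → Arcs → List Arcs
  eliminateAll [] arcs = arcs ∷ []
  eliminateAll (v ∷ us) arcs = concatMap (eliminateAll us) (eliminate v arcs)

  data AllExposed (vs : List Node) : List Star → Set where
    []  : AllExposed vs []
    _∷_ : ∀ {v us} → Exposed v (map centre us ++ vs) → AllExposed vs us → AllExposed vs (v ∷ us)

  private
    sum-concatMap : (n : Arcs → ℕ) (f : Arcs → List Arcs) (as : List Arcs) →
      sum (map (λ a → sum (map n (f a))) as) ≡ sum (map n (concatMap f as))
    sum-concatMap n f [] = refl
    sum-concatMap n f (a ∷ as) = sym (trans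
      (trans (cong sum (map-++ n (f a) (concatMap f as))) (sum-++ (map n (f a)) _))
      (cong (sum (map n (f a)) ℕ.+_) (sym (sum-concatMap n f as))))

  count-eliminateAll : ∀ {vs us} arcs → AllExposed vs us → (n : Arcs → ℕ) →
    (∀ {a} → a ∈ eliminateAll us arcs → Count (Path a vs) (n a)) →
    Count (Path arcs (map centre us ++ vs)) (sum (map n (eliminateAll us arcs)))
  count-eliminateAll arcs [] n c =
    subst (Count _) (sym (ℕ.+-identityʳ (n arcs))) (c (here refl))
  count-eliminateAll {us = v ∷ us} arcs (ex ∷ exs) n c =
    subst (Count _) (sum-concatMap n (eliminateAll us) (eliminate v arcs))
      (count-eliminate ex _ λ {a} a∈ → count-eliminateAll a exs n λ b∈ → c (∈-concatMap⁺ a∈ b∈))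
    where
    ∈-concatMap⁺ : ∀ {a b as} → a ∈ as → b ∈ eliminateAll us a → b ∈ concatMap (eliminateAll us) as
    ∈-concatMap⁺ (here refl) b∈ = ∈-++⁺ˡ b∈
    ∈-concatMap⁺ {as = a ∷ _} (there a∈) b∈ = ∈-++⁺ʳ (eliminateAll us a) (∈-concatMap⁺ a∈ b∈)

  path-cong : ∀ {arcs arcs′ vs l} → (∀ {e} → e ∈ arcs ⇔ e ∈ arcs′) → Path arcs vs l → Path arcs′ vs l
  path-cong eq π = record
    { unique = unique π ; visits = visits π ; from-S = from-S π ; to-T = to-T π
    ; steps = λ n → [ inj₁ , inj₂ ∘ to eq ]′ (steps π n)
    ; required = required π ∘ from eq }

  count-path-cong : ∀ {arcs arcs′ vs n} → (∀ {e} → e ∈ arcs ⇔ e ∈ arcs′) →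
                    Count (Path arcs vs) n → Count (Path arcs′ vs) n
  count-path-cong eq = count-cong (mk⇔ (path-cong eq) (path-cong (mk⇔ (from eq) (to eq))))

  -- Transport of paths along an injection

  module Relabelling (f : Node → Node) (f-injective : ∀ {x y} → f x ≡ f y → x ≡ y)
                     (fS : f S ≡ S) (fT : f T ≡ T) (E-f : ∀ {x y} → E x y ⇔ E (f x) (f y)) where

    relabel : Arcs → Arcs
    relabel = map λ (x , y) → f x , f y

    private
      relabel-∈⁻ : ∀ {arcs x y} → (x , y) ∈ relabel arcs →
                   ∃ λ a → ∃ λ b → (a , b) ∈ arcs × x ≡ f a × y ≡ f b
      relabel-∈⁻ e∈ with (a , b) , e∈′ , refl ← ∈-map⁻ _ e∈ = a , b , e∈′ , refl , refl

      relabel-∈-injective : ∀ {arcs x y} → (f x , f y) ∈ relabel arcs → (x , y) ∈ arcs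
      relabel-∈-injective e∈ with a , b , e∈′ , ex , ey ← relabel-∈⁻ e∈
        with refl ← f-injective ex | refl ← f-injective ey = e∈′

      ends⁺ : ∀ {vs x} → x ∈ map f (S ∷ T ∷ vs) → x ∈ S ∷ T ∷ map f vs
      ends⁺ {vs} {x} = subst (x ∈_) (cong₂ (λ s t → s ∷ t ∷ map f vs) fS fT)

      ends⁻ : ∀ {vs x} → x ∈ S ∷ T ∷ map f vs → x ∈ map f (S ∷ T ∷ vs)
      ends⁻ {vs} {x} = subst (x ∈_) (sym (cong₂ (λ s t → s ∷ t ∷ map f vs) fS fT))

      ∈-map-injective : ∀ {x l} → f x ∈ map f l → x ∈ l
      ∈-map-injective x∈ with y , y∈ , e ← ∈-map⁻ f x∈ with refl ← f-injective e = y∈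

    relabel-path : ∀ {arcs vs l} → Path arcs vs l → Path (relabel arcs) (map f vs) (map f l)
    relabel-path π = record
      { unique = Unique.map⁺ f-injective (unique π)
      ; visits = mk⇔
          (λ x∈ → case ∈-map⁻ f x∈ of λ where
            (y , y∈ , refl) → ends⁺ (∈-map⁺ f (to (visits π) y∈)))
          (λ x∈ → case ∈-map⁻ f (ends⁻ x∈) of λ where
            (y , y∈ , refl) → ∈-map⁺ f (from (visits π) y∈))
      ; from-S = λ n → case next-map⁻ f n of λ where
          (a , b , n′ , _ , e) → from-S π (subst (Next _ a) (f-injective (trans (sym e) (sym fS))) n′)
      ; to-T = λ n → case next-map⁻ f n of λ where
          (a , b , n′ , e , _) → to-T π (subst (λ z → Next _ z b) (f-injective (trans (sym e) (sym fT))) n′)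
      ; steps = λ n → case next-map⁻ f n of λ where
          (a , b , n′ , refl , refl) → [ inj₁ ∘ to E-f , inj₂ ∘ ∈-map⁺ _ ]′ (steps π n′)
      ; required = λ e∈ → case relabel-∈⁻ e∈ of λ where
          (a , b , e∈′ , refl , refl) → next-map⁺ f (required π e∈′)
      }

    relabel-path⁻ : ∀ {arcs vs l} → Path (relabel arcs) (map f vs) (map f l) → Path arcs vs l
    relabel-path⁻ π = record
      { unique = Unique.map⁻ (unique π)
      ; visits = mk⇔
          (λ x∈ → ∈-map-injective (ends⁻ (to (visits π) (∈-map⁺ f x∈))))
          (λ x∈ → ∈-map-injective (from (visits π) (ends⁺ (∈-map⁺ f x∈))))
      ; from-S = λ {x} n → from-S π (subst (Next _ (f x)) fS (next-map⁺ f n))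
      ; to-T = λ {x} n → to-T π (subst (λ z → Next _ z (f x)) fT (next-map⁺ f n))
      ; steps = λ n → [ inj₁ ∘ from E-f , inj₂ ∘ relabel-∈-injective ]′ (steps π (next-map⁺ f n))
      ; required = λ e∈ → next-map-injective f f-injective (required π (∈-map⁺ _ e∈))
      }

    private
      -- `f` need not be onto, so a path on relabelled nodes must first be seen to consist of values
      -- of `f`.
      preimage : ∀ {vs} l → (∀ {x} → x ∈ l → x ∈ map f vs) → ∃ λ l′ → l ≡ map f l′
      preimage [] _ = [] , refl
      preimage (x ∷ l) all with y , _ , refl ← ∈-map⁻ f (all (here refl))
        with l′ , refl ← preimage l (all ∘ there) = y ∷ l′ , refl

    count-relabel : ∀ {arcs vs n} → Count (Path arcs vs) n →
                    Count (Path (relabel arcs) (map f vs)) n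
    count-relabel {arcs} {vs} c = count-cong
      (mk⇔ (λ { (l , π , refl) → relabel-path π })
           (λ π → case preimage _ (λ x∈ → ends⁻ (to (visits π) x∈)) of λ where
              (l′ , refl) → l′ , relabel-path⁻ π , refl))
      (count-image (map f) (λ _ _ → map-injective f-injective) c)

-- The grid of height 4

data Node : Set where
  S T : Node
  at  : Fin 4 → ℕ → Node

at-injective : ∀ {r r′ c c′} → at r c ≡ at r′ c′ → r ≡ r′ × c ≡ c′
at-injective refl = refl , refl

_≟ₙ_ : DecidableEquality Node
S ≟ₙ S = yes refl
S ≟ₙ T = no λ ()
S ≟ₙ at _ _ = no λ ()
T ≟ₙ S = no λ ()
T ≟ₙ T = yes refl
T ≟ₙ at _ _ = no λ ()
at _ _ ≟ₙ S = no λ ()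
at _ _ ≟ₙ T = no λ ()
at r c ≟ₙ at r′ c′ =
  map′ (λ (p , q) → cong₂ at p q) at-injective ((r Fin.≟ r′) ×-dec (c ℕ.≟ c′))

-- T can be entered from every vertex, so an unconstrained end of a walk needs no arc.
Edge : Node → Node → Set
Edge (at r c) (at r′ c′) = ∣ toℕ r - toℕ r′ ∣ ℕ.+ ∣ c - c′ ∣ ≡ 1
Edge (at _ _) T = ⊤
Edge _ _ = ⊥

open Walks _≟ₙ_ S T Edge
open DecUnique _≟ₙ_ using (unique?)

shift : Node → Node
shift S = S
shift T = T
shift (at r c) = at r (suc c)

shift-injective : ∀ {x y} → shift x ≡ shift y → x ≡ y
shift-injective {S} {S} _ = refl
shift-injective {T} {T} _ = refl
shift-injective {at _ _} {at _ _} refl = refl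

shift-edge : ∀ {x y} → Edge x y ⇔ Edge (shift x) (shift y)
shift-edge {S} {S} = mk⇔ id id
shift-edge {S} {T} = mk⇔ id id
shift-edge {S} {at _ _} = mk⇔ id id
shift-edge {T} {S} = mk⇔ id id
shift-edge {T} {T} = mk⇔ id id
shift-edge {T} {at _ _} = mk⇔ id id
shift-edge {at _ _} {S} = mk⇔ id id
shift-edge {at _ _} {T} = mk⇔ id id
shift-edge {at _ _} {at _ _} = mk⇔ id id

open Relabelling shift shift-injective refl refl (λ {x} {y} → shift-edge {x} {y})

-- Columns are eliminated from the top down, so the vertex above is already gone.
below : Fin 4 → List Node
below 0F = at 1F 0 ∷ []
below 1F = at 2F 0 ∷ []
below 2F = at 3F 0 ∷ []
below 3F = []

-- `at r 1` is listed even for the last column, where it is absent; thus one star serves grids of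
-- every width. `S` is left only through an arc and is never listed.
site : Fin 4 → Star
site r = star (at r 0) (below r ++ at r 1 ∷ []) (below r ++ at r 1 ∷ T ∷ [])

column : List Star
column = map site (allFin 4)

-- Without its first column the grid is literally the shift of a narrower one, the form that
-- `count-relabel` applies to.
cells : ℕ → List Node
cells zero    = []
cells (suc n) = map Star.centre column ++ map shift (cells n)

cells-at : ∀ n {x} → x ∈ cells n → ∃ λ r → ∃ λ c → x ≡ at r c
cells-at (suc n) (here refl) = _ , _ , refl
cells-at (suc n) (there (here refl)) = _ , _ , refl
cells-at (suc n) (there (there (here refl))) = _ , _ , refl
cells-at (suc n) (there (there (there (here refl)))) = _ , _ , refl
cells-at (suc n) (there (there (there (there x∈)))) with y , y∈ , refl ← ∈-map⁻ shift x∈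
  with _ , _ , refl ← cells-at n y∈ = _ , _ , refl

∈-cells⁺ : ∀ {n} r {c} → c ℕ.< n → at r c ∈ cells n
∈-cells⁺ r {zero} (ℕ.s≤s _) = ∈-++⁺ˡ (∈-map⁺ (Star.centre ∘ site) (∈-allFin r))
∈-cells⁺ r {suc c} (ℕ.s≤s c<n) = ∈-++⁺ʳ _ (∈-map⁺ shift (∈-cells⁺ r c<n))

∈-cells⁻ : ∀ n {r c} → at r c ∈ cells n → c ℕ.< n
∈-cells⁻ (suc n) (here refl) = ℕ.s≤s ℕ.z≤n
∈-cells⁻ (suc n) (there (here refl)) = ℕ.s≤s ℕ.z≤n
∈-cells⁻ (suc n) (there (there (here refl))) = ℕ.s≤s ℕ.z≤n
∈-cells⁻ (suc n) (there (there (there (here refl)))) = ℕ.s≤s ℕ.z≤n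
∈-cells⁻ (suc n) (there (there (there (there x∈)))) with y , y∈ , e ← ∈-map⁻ shift x∈
  with y | e
... | at _ _ | refl = ℕ.s≤s (∈-cells⁻ n y∈)

edge-sym : ∀ {r c r′ c′} → Edge (at r c) (at r′ c′) → Edge (at r′ c′) (at r c)
edge-sym {r} {c} {r′} {c′} =
  trans (cong₂ ℕ._+_ (ℕ.∣-∣-comm (toℕ r′) (toℕ r)) (ℕ.∣-∣-comm c′ c))

edge-to-next-column : ∀ {r r′ c} → Edge (at r 0) (at r′ (suc c)) → at r′ (suc c) ≡ at r 1
edge-to-next-column {r} {r′} {c} e = cong₂ at
  (sym (Fin.toℕ-injective (ℕ.∣m-n∣≡0⇒m≡n (ℕ.m+n≡0⇒m≡0 _ d+c≡0))))
  (cong suc (ℕ.m+n≡0⇒n≡0 ∣ toℕ r - toℕ r′ ∣ d+c≡0))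
  where
  -- The column distance is `suc c`, which already uses up the whole distance 1.
  d+c≡0 : ∣ toℕ r - toℕ r′ ∣ ℕ.+ c ≡ 0
  d+c≡0 = ℕ.suc-injective (trans (sym (ℕ.+-suc _ c)) e)

edge-to-right : ∀ r → Edge (at r 0) (at r 1)
edge-to-right r = cong (ℕ._+ 1) (ℕ.∣n-n∣≡0 (toℕ r))

edge-below : ∀ r {x} → x ∈ below r → Edge (at r 0) x × Edge x (at r 0)
edge-below 0F (here refl) = refl , refl
edge-below 1F (here refl) = refl , refl
edge-below 2F (here refl) = refl , refl
edge-below 3F ()

neighbours-unique : ∀ r → Unique (Star.incoming (site r)) × Unique (Star.outgoing (site r))
neighbours-unique = toWitness {a? = Fin.all? λ r →
  unique? (Star.incoming (site r)) ×-dec unique? (Star.outgoing (site r))} tt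

site-exposed : ∀ r rs n → r ∉ rs →
  (∀ {r′} → r′ ∈ rs → Edge (at r 0) (at r′ 0) → at r′ 0 ∈ below r) →
  Exposed (site r) (map Star.centre (map site rs) ++ map shift (cells n))
site-exposed r rs n r∉ adjacent = record
  { fresh = λ where
      (there (there x∈)) → case later⁻ x∈ of λ where
        (_ , _ , e , inj₁ (r∈ , refl)) → r∉ (subst (_∈ rs) (sym (proj₁ (at-injective e))) r∈)
        (_ , _ , e , inj₂ (_ , refl)) → case proj₂ (at-injective e) of λ ()
  ; incoming-unique = proj₁ (neighbours-unique r)
  ; outgoing-unique = proj₂ (neighbours-unique r)
  ; incoming⁺ = λ where
      (here refl) ()
      (there (here refl)) ()
      (there (there x∈)) e → case later⁻ x∈ of λ where
        (r′ , c′ , refl , l) → near l (edge-sym {r′} {c′} {r} {0} e)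
  ; incoming⁻ = λ x∈ → case ∈-++⁻ (below r) x∈ of λ where
      (inj₁ y∈) → proj₂ (edge-below r y∈)
      (inj₂ (here refl)) → edge-sym {r} {0} {r} {1} (edge-to-right r)
  ; outgoing⁺ = λ where
      (here refl) ()
      (there (here refl)) _ → ∈-++⁺ʳ (below r) (there (here refl))
      (there (there x∈)) e → case later⁻ x∈ of λ where
        (r′ , c′ , refl , l) → case ∈-++⁻ (below r) (near l e) of λ where
          (inj₁ y∈) → ∈-++⁺ˡ y∈
          (inj₂ (here e)) → ∈-++⁺ʳ (below r) (here e)
  ; outgoing⁻ = λ x∈ → case ∈-++⁻ (below r) x∈ of λ where
      (inj₁ y∈) → proj₁ (edge-below r y∈)
      (inj₂ (here refl)) → edge-to-right r
      (inj₂ (there (here refl))) → tt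
  }
  where
  Later : Fin 4 → ℕ → Set
  Later r′ c = (r′ ∈ rs × c ≡ 0) ⊎ ∃ λ c′ → c ≡ suc c′

  later⁻ : ∀ {x} → x ∈ map Star.centre (map site rs) ++ map shift (cells n) →
           ∃ λ r′ → ∃ λ c → x ≡ at r′ c × Later r′ c
  later⁻ x∈ with ∈-++⁻ (map Star.centre (map site rs)) x∈
  ... | inj₁ y∈ with _ , z∈ , refl ← ∈-map⁻ Star.centre y∈
                with r′ , r∈ , refl ← ∈-map⁻ site z∈ = r′ , 0 , refl , inj₁ (r∈ , refl)
  ... | inj₂ y∈ with _ , z∈ , refl ← ∈-map⁻ shift y∈
                with r′ , c , refl ← cells-at n z∈ = r′ , suc c , refl , inj₂ (c , refl)

  near : ∀ {r′ c} → Later r′ c → Edge (at r 0) (at r′ c) → at r′ c ∈ below r ++ at r 1 ∷ []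
  near (inj₁ (r∈ , refl)) e = ∈-++⁺ˡ (adjacent r∈ e)
  near (inj₂ (_ , refl)) e = ∈-++⁺ʳ (below r) (here (edge-to-next-column e))

column-exposed : ∀ n → AllExposed (map shift (cells n)) column
column-exposed n =
  site-exposed 0F (1F ∷ 2F ∷ 3F ∷ []) n
    (λ { (here ()) ; (there (here ())) ; (there (there (here ()))) })
    (λ { (here refl) _ → here refl ; (there (here refl)) () ; (there (there (here refl))) () }) ∷
  site-exposed 1F (2F ∷ 3F ∷ []) n
    (λ { (here ()) ; (there (here ())) })
    (λ { (here refl) _ → here refl ; (there (here refl)) () }) ∷
  site-exposed 2F (3F ∷ []) n (λ { (here ()) }) (λ { (here refl) _ → here refl }) ∷
  site-exposed 3F [] n (λ ()) (λ ()) ∷ []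

-- Frontier states

_≟ₐ_ : DecidableEquality (Node × Node)
_≟ₐ_ = ×.≡-dec _≟ₙ_ _≟ₙ_

open DecMembership _≟ₐ_ using (_∈?_)

-- `Path` depends only on membership, while elimination leaves the arcs in an order that depends on
-- its history.
SameArcs : Arcs → Arcs → Set
SameArcs a b = All (_∈ b) a × All (_∈ a) b

sameArcs? : ∀ a b → Dec (SameArcs a b)
sameArcs? a b = All.all? (_∈? b) a ×-dec All.all? (_∈? a) b

same-∈ : ∀ {a b} → SameArcs a b → ∀ {e} → e ∈ a ⇔ e ∈ b
same-∈ (a⊆b , b⊆a) = mk⇔ (All.lookup a⊆b) (All.lookup b⊆a)

infix 6 _⟶_
_⟶_ : Node → Node → Node × Node
_⟶_ = _,_

r₀ r₁ r₂ r₃ : Node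
r₀ = at 0F 0
r₁ = at 1F 0
r₂ = at 2F 0
r₃ = at 3F 0

finished : Arcs
finished = S ⟶ T ∷ []

-- No edge leaves `S`, so this arc is what makes the walk begin in the upper-left corner.
started : Arcs
started = S ⟶ r₀ ∷ []

empty-path : ∀ {a} → SameArcs a finished → Path a [] (S ∷ T ∷ [])
empty-path (a⊆ , S→T∈a ∷ []) = record
  { unique = ((λ ()) ∷ []) ∷ [] ∷ []
  ; visits = mk⇔ id id
  ; from-S = λ { (there (there ())) }
  ; to-T = λ { (there (there ())) }
  ; steps = λ { here → inj₂ S→T∈a ; (there (there ())) }
  ; required = λ e∈ → case All.lookup a⊆ e∈ of λ { (here refl) → here } }

empty-path⁻ : ∀ {a l} → Path a [] l → l ≡ S ∷ T ∷ [] × SameArcs a finished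
empty-path⁻ {a} {l} π = l≡ , (All.tabulate a⊆ , S→T∈a ∷ [])
  where
  open Path π

  S→T : Next l S T
  S→T with successor (from visits (here refl)) (from visits (there (here refl))) (λ ())
  ... | inj₂ (_ , n) = contradiction n to-T
  ... | inj₁ (y , n) with to visits (next-target∈ n)
  ...   | here refl = contradiction refl (next-irrefl unique n)
  ...   | there (here refl) = n

  S→T∈a : (S , T) ∈ a
  S→T∈a = case steps S→T of λ { (inj₂ e∈) → e∈ }

  a⊆ : ∀ {e} → e ∈ a → e ∈ finished
  a⊆ e∈ with n ← required e∈ with to visits (next-source n) | to visits (next-target∈ n)
  ... | here refl | here refl = contradiction n from-S
  ... | here refl | there (here refl) = here refl
  ... | there (here refl) | _ = contradiction n to-T

  two : ∀ {l} → Next l S T →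
        (∀ {x} → ¬ Next l x S) → (∀ {x} → ¬ Next l T x) → l ≡ S ∷ T ∷ []
  two {.S ∷ .T ∷ []} here nS nT = refl
  two {.S ∷ .T ∷ _ ∷ _} here nS nT = contradiction (there here) nT
  two {_ ∷ _} (there n) nS nT with predecessor-in-tail (next-source n)
  ... | _ , m = contradiction m nS

  l≡ : l ≡ S ∷ T ∷ []
  l≡ = two S→T from-S to-T

-- Only `S` and `T` are left and no edge joins them, so the one step has to be an arc. Any arc that
-- points beyond the last column is refused here.
count-empty : ∀ {a} (same : Dec (SameArcs a finished)) →
              Count (Path a []) (if does same then 1 else 0)
count-empty (yes s) = (S ∷ T ∷ []) ∷ [] , [] ∷ [] ,
  mk⇔ (λ { (here refl) → empty-path s }) (λ π → here (proj₁ (empty-path⁻ π))) , refl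
count-empty (no ¬s) = count-none λ π → ¬s (proj₂ (empty-path⁻ π))

step : Arcs → List Arcs
step = eliminateAll column

-- Linear recurrences

infixl 6 _⊕_
_⊕_ : ∀ {k} → Vec ℤ k → Vec ℤ k → Vec ℤ k
_⊕_ = Vec.zipWith ℤ._+_

zeros : ∀ {k} → Vec ℤ k
zeros = Vec.replicate _ 0ℤ

dot : ∀ {k} → Vec ℤ k → Vec ℤ k → ℤ
dot []      []      = 0ℤ
dot (x ∷ u) (y ∷ v) = x ℤ.* y ℤ.+ dot u v

Σᵥ : ∀ {k} → List (Vec ℤ k) → Vec ℤ k
Σᵥ = foldr _⊕_ zeros

infixr 7 _·_
_·_ : ∀ {k} → ℤ → Vec ℤ k → Vec ℤ k
c · u = Vec.map (c ℤ.*_) u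

infixr 7 _⊠_
_⊠_ : ∀ {k m} → Vec (Vec ℤ k) m → Vec ℤ k → Vec ℤ m
M ⊠ v = Vec.map (λ r → dot r v) M

infixl 7 _⊡_
_⊡_ : ∀ {k m} → Vec ℤ k → Vec (Vec ℤ m) k → Vec ℤ m
[]      ⊡ []      = zeros
(c ∷ u) ⊡ (r ∷ M) = c · r ⊕ u ⊡ M

dot-zeros : ∀ {k} (v : Vec ℤ k) → dot zeros v ≡ 0ℤ
dot-zeros []      = refl
dot-zeros (y ∷ v) = cong₂ ℤ._+_ (ℤ.*-zeroˡ y) (dot-zeros v)

dot-⊕ : ∀ {k} (u u′ v : Vec ℤ k) → dot (u ⊕ u′) v ≡ dot u v ℤ.+ dot u′ v
dot-⊕ []      []        []      = refl
dot-⊕ (x ∷ u) (x′ ∷ u′) (y ∷ v) = trans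
  (cong₂ ℤ._+_ (ℤ.*-distribʳ-+ y x x′) (dot-⊕ u u′ v))
  (interchange ℤ.+-commutativeSemigroup (x ℤ.* y) (x′ ℤ.* y) (dot u v) (dot u′ v))

dot-· : ∀ {k} c (u v : Vec ℤ k) → dot (c · u) v ≡ c ℤ.* dot u v
dot-· c []      []      = sym (ℤ.*-zeroʳ c)
dot-· c (x ∷ u) (y ∷ v) = trans
  (cong₂ ℤ._+_ (ℤ.*-assoc c x y) (dot-· c u v))
  (sym (ℤ.*-distribˡ-+ c (x ℤ.* y) (dot u v)))

-- Associativity, (u M) v = u (M v). It moves a transfer step from the counts to the weights, so
-- that a relation between the rows u M^j holds at every width.
dot-⊡ : ∀ {k m} (u : Vec ℤ k) (M : Vec (Vec ℤ m) k) v →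
        dot (u ⊡ M) v ≡ dot u (M ⊠ v)
dot-⊡ []      []      v = dot-zeros v
dot-⊡ (c ∷ u) (r ∷ M) v =
  trans (dot-⊕ (c · r) (u ⊡ M) v) (cong₂ ℤ._+_ (dot-· c r v) (dot-⊡ u M v))

module Frontier {I : Set} (arcs : I → Arcs) (index : Arcs → I)
  (closed : ∀ i → All (λ a → SameArcs (relabel (arcs (index a))) a) (step (arcs i))) where

  walks : ℕ → I → ℕ
  walks zero    i = if does (sameArcs? (arcs i) finished) then 1 else 0
  walks (suc n) i = sum (map (walks n ∘ index) (step (arcs i)))

  count-walks : ∀ n i → Count (Path (arcs i) (cells n)) (walks n i)
  count-walks zero    i = count-empty (sameArcs? (arcs i) finished)
  count-walks (suc n) i = count-eliminateAll (arcs i) (column-exposed n) (walks n ∘ index)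
    λ {a} a∈ → count-path-cong (same-∈ (All.lookup (closed i) a∈))
                 (count-relabel (count-walks n (index a)))

  module Valuation {k : ℕ} (value : I → Vec ℤ k) (initial : Vec ℤ k) (transfer : Vec (Vec ℤ k) k)
    (value-initial : ∀ i → + (if does (sameArcs? (arcs i) finished) then 1 else 0) ≡ dot (value i) initial)
    (value-step : ∀ i → Σᵥ (map (value ∘ index) (step (arcs i))) ≡ value i ⊡ transfer) where

    basis : ℕ → Vec ℤ k
    basis zero    = initial
    basis (suc n) = transfer ⊠ basis n

    walks-value : ∀ n i → + walks n i ≡ dot (value i) (basis n)
    walks-value zero    i = value-initial i
    walks-value (suc n) i = begin
      + sum (map (walks n ∘ index) as)    ≡⟨ sum-value as ⟩
      dot (Σᵥ (map (value ∘ index) as)) (basis n)     ≡⟨ cong (λ u → dot u (basis n)) (value-step i) ⟩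
      dot (value i ⊡ transfer) (basis n)              ≡⟨ dot-⊡ (value i) transfer (basis n) ⟩
      dot (value i) (basis (suc n))                   ∎
      where
      open ≡-Reasoning

      as : List Arcs
      as = step (arcs i)

      sum-value : ∀ as → + sum (map (walks n ∘ index) as) ≡
                         dot (Σᵥ (map (value ∘ index) as)) (basis n)
      sum-value []       = sym (dot-zeros (basis n))
      sum-value (a ∷ as) = trans
        (ℤ.pos-+ (walks n (index a)) _)
        (trans (cong₂ ℤ._+_ (walks-value n (index a)) (sum-value as))
               (sym (dot-⊕ (value (index a)) (Σᵥ (map (value ∘ index) as)) (basis n))))

-- The table of states

Value : Set
Value = Vec ℤ 12

e : Fin 12 → Value
e i = Vec.updateAt (Vec.replicate 12 0ℤ) i (λ _ → 1ℤ)

State : Set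
State = Arcs × Value

valued : Value → List Arcs → List State
valued v = map (_, v)

-- The sets of arcs reachable from started, grouped by value.  The value of a state gives its
-- path counts as a combination of the counts of twelve states, those of value e i; mirror
-- images have the same value, and there is no path at all for the states of value zeros.
table : List State
table =
  valued (e 0F) ((S ⟶ r₀ ∷ []) ∷ (S ⟶ r₃ ∷ []) ∷ []) ++
  valued (e 1F) ((S ⟶ T ∷ []) ∷ []) ++
  valued (e 2F) ((S ⟶ r₂ ∷ r₃ ⟶ T ∷ []) ∷ (S ⟶ r₀ ∷ r₁ ⟶ T ∷ []) ∷
    (S ⟶ r₀ ∷ r₁ ⟶ T ∷ r₃ ⟶ r₂ ∷ []) ∷ (S ⟶ r₃ ∷ r₂ ⟶ T ∷ []) ∷ (S ⟶ r₃ ∷ r₀ ⟶ r₁ ∷ r₂ ⟶ T ∷ []) ∷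
    (S ⟶ r₁ ∷ r₀ ⟶ T ∷ []) ∷ (S ⟶ r₂ ∷ r₁ ⟶ r₀ ∷ r₃ ⟶ T ∷ []) ∷ (S ⟶ r₁ ∷ r₀ ⟶ T ∷ r₂ ⟶ r₃ ∷ []) ∷
    (S ⟶ r₀ ∷ r₂ ⟶ T ∷ r₃ ⟶ r₁ ∷ []) ∷ (S ⟶ r₃ ∷ r₀ ⟶ r₂ ∷ r₁ ⟶ T ∷ []) ∷ []) ++
  valued (e 3F) ((S ⟶ r₁ ∷ r₃ ⟶ r₂ ∷ []) ∷ (S ⟶ r₂ ∷ r₀ ⟶ r₁ ∷ []) ∷ (S ⟶ r₀ ∷ r₂ ⟶ r₁ ∷ []) ∷
    (S ⟶ r₃ ∷ r₁ ⟶ r₂ ∷ []) ∷ []) ++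
  valued (e 4F) ((S ⟶ r₁ ∷ r₂ ⟶ r₃ ∷ []) ∷ (S ⟶ r₂ ∷ r₁ ⟶ r₀ ∷ []) ∷ []) ++
  valued (e 5F) ((S ⟶ r₁ ∷ r₂ ⟶ T ∷ []) ∷ (S ⟶ r₂ ∷ r₁ ⟶ T ∷ []) ∷ []) ++
  valued (e 6F) ((S ⟶ r₀ ∷ r₃ ⟶ r₁ ∷ []) ∷ (S ⟶ r₃ ∷ r₀ ⟶ r₂ ∷ []) ∷ (S ⟶ r₀ ∷ r₃ ⟶ r₂ ∷ []) ∷
    (S ⟶ r₃ ∷ r₀ ⟶ r₁ ∷ []) ∷ []) ++
  valued (e 7F) ((S ⟶ r₀ ∷ r₃ ⟶ T ∷ []) ∷ (S ⟶ r₃ ∷ r₀ ⟶ T ∷ []) ∷ []) ++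
  valued (e 8F) ((S ⟶ r₀ ∷ r₁ ⟶ r₃ ∷ []) ∷ (S ⟶ r₃ ∷ r₂ ⟶ r₀ ∷ []) ∷ []) ++
  valued (e 9F) ((S ⟶ r₀ ∷ r₁ ⟶ r₂ ∷ r₃ ⟶ T ∷ []) ∷ (S ⟶ r₃ ∷ r₀ ⟶ T ∷ r₂ ⟶ r₁ ∷ []) ∷
    (S ⟶ r₀ ∷ r₁ ⟶ r₃ ∷ r₂ ⟶ T ∷ []) ∷ (S ⟶ r₃ ∷ r₁ ⟶ T ∷ r₂ ⟶ r₀ ∷ []) ∷ []) ++
  valued (e (# 10)) ((S ⟶ r₀ ∷ r₂ ⟶ r₃ ∷ []) ∷ (S ⟶ r₃ ∷ r₁ ⟶ r₀ ∷ []) ∷ []) ++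
  -- A walk from `r₁` cannot end in the corner `r₃`: both have the same colour and the number of
  -- vertices is even. So `r₃` has a neighbour on either side, one of them `r₂`, and the two
  -- directions of that edge are the states counted by `e 3F` and `e 4F`.
  valued (e 3F ⊕ e 4F) ((S ⟶ r₂ ∷ []) ∷ (S ⟶ r₁ ∷ []) ∷ []) ++
  valued (e (# 11)) ((S ⟶ r₀ ∷ r₁ ⟶ r₂ ∷ []) ∷ (S ⟶ r₃ ∷ r₂ ⟶ r₁ ∷ []) ∷ []) ++
  -- Three obstructions occur: `S ⟶ T` leaves no room for other arcs; two ends in column 0 at
  -- distance 2 have the same colour; and otherwise a stretch between `r₀` and `r₂` would have to
  -- cross one between `r₁` and `r₃`.
  valued zeros ((S ⟶ r₁ ∷ r₃ ⟶ T ∷ []) ∷ (S ⟶ T ∷ r₃ ⟶ r₂ ∷ []) ∷ (S ⟶ T ∷ r₂ ⟶ r₃ ∷ []) ∷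
    (S ⟶ r₀ ∷ r₂ ⟶ r₁ ∷ r₃ ⟶ T ∷ []) ∷ (S ⟶ r₀ ∷ r₁ ⟶ T ∷ r₂ ⟶ r₃ ∷ []) ∷ (S ⟶ T ∷ r₃ ⟶ r₁ ∷ []) ∷
    (S ⟶ T ∷ r₁ ⟶ r₃ ∷ []) ∷ (S ⟶ T ∷ r₂ ⟶ r₀ ∷ []) ∷ (S ⟶ T ∷ r₁ ⟶ r₀ ∷ []) ∷
    (S ⟶ r₃ ∷ r₁ ⟶ r₀ ∷ r₂ ⟶ T ∷ []) ∷ (S ⟶ T ∷ r₀ ⟶ r₂ ∷ []) ∷ (S ⟶ T ∷ r₀ ⟶ r₁ ∷ []) ∷
    (S ⟶ r₂ ∷ r₀ ⟶ T ∷ []) ∷ (S ⟶ r₃ ∷ r₀ ⟶ T ∷ r₁ ⟶ r₂ ∷ []) ∷ (S ⟶ T ∷ r₃ ⟶ r₀ ∷ []) ∷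
    (S ⟶ T ∷ r₁ ⟶ r₀ ∷ r₃ ⟶ r₂ ∷ []) ∷ (S ⟶ T ∷ r₁ ⟶ r₀ ∷ r₂ ⟶ r₃ ∷ []) ∷ (S ⟶ T ∷ r₀ ⟶ r₃ ∷ []) ∷
    (S ⟶ T ∷ r₀ ⟶ r₁ ∷ r₃ ⟶ r₂ ∷ []) ∷ (S ⟶ T ∷ r₀ ⟶ r₁ ∷ r₂ ⟶ r₃ ∷ []) ∷
    (S ⟶ r₂ ∷ r₀ ⟶ r₁ ∷ r₃ ⟶ T ∷ []) ∷ (S ⟶ r₁ ∷ r₀ ⟶ T ∷ r₃ ⟶ r₂ ∷ []) ∷ (S ⟶ r₀ ∷ r₂ ⟶ T ∷ []) ∷
    (S ⟶ T ∷ r₂ ⟶ r₁ ∷ []) ∷ (S ⟶ T ∷ r₁ ⟶ r₂ ∷ []) ∷ (S ⟶ r₃ ∷ r₁ ⟶ T ∷ []) ∷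
    (S ⟶ T ∷ r₂ ⟶ r₁ ∷ r₃ ⟶ r₀ ∷ []) ∷ (S ⟶ T ∷ r₁ ⟶ r₂ ∷ r₃ ⟶ r₀ ∷ []) ∷
    (S ⟶ T ∷ r₀ ⟶ r₃ ∷ r₂ ⟶ r₁ ∷ []) ∷ (S ⟶ T ∷ r₀ ⟶ r₃ ∷ r₁ ⟶ r₂ ∷ []) ∷ [])

arcs : Fin (length table) → Arcs
arcs i = proj₁ (lookup table i)

value : Fin (length table) → Value
value i = proj₂ (lookup table i)

index : Arcs → Fin (length table)
-- The default cannot go unnoticed: it is taken only if no state matches, state `0F` included, and
-- then `table-closed` fails.
index a = fromMaybe 0F (findIndex (λ s → sameArcs? (relabel (proj₁ s)) a) table)

table-closed : ∀ i → All (λ a → SameArcs (relabel (arcs (index a))) a) (step (arcs i))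
table-closed = toWitness {a? = Fin.all? λ i →
  All.all? (λ a → sameArcs? (relabel (arcs (index a))) a) (step (arcs i))} tt

-- Row `i` is the summed value of the successors of a state of value `e i`; `value-step` confirms
-- that every such state gives the same row.
transfer : Vec Value 12
transfer =
  ((1ℤ ∷ 1ℤ ∷ + 3 ∷ 1ℤ ∷ 1ℤ ∷ 1ℤ ∷ 1ℤ ∷ 1ℤ ∷ 1ℤ ∷ 1ℤ ∷ 0ℤ ∷ 0ℤ ∷ []) ∷
   (0ℤ ∷ 0ℤ ∷ 0ℤ ∷ 0ℤ ∷ 0ℤ ∷ 0ℤ ∷ 0ℤ ∷ 0ℤ ∷ 0ℤ ∷ 0ℤ ∷ 0ℤ ∷ 0ℤ ∷ []) ∷
   (0ℤ ∷ 0ℤ ∷ 1ℤ ∷ 0ℤ ∷ 0ℤ ∷ 0ℤ ∷ 0ℤ ∷ 1ℤ ∷ 0ℤ ∷ 0ℤ ∷ 0ℤ ∷ 0ℤ ∷ []) ∷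
   (0ℤ ∷ 0ℤ ∷ 0ℤ ∷ 0ℤ ∷ 0ℤ ∷ 0ℤ ∷ 1ℤ ∷ 1ℤ ∷ 0ℤ ∷ 0ℤ ∷ 0ℤ ∷ 0ℤ ∷ []) ∷
   (0ℤ ∷ 0ℤ ∷ 1ℤ ∷ 0ℤ ∷ 0ℤ ∷ 0ℤ ∷ 0ℤ ∷ 1ℤ ∷ 0ℤ ∷ 0ℤ ∷ 1ℤ ∷ 0ℤ ∷ []) ∷
   (0ℤ ∷ 0ℤ ∷ 0ℤ ∷ 0ℤ ∷ 0ℤ ∷ 0ℤ ∷ 0ℤ ∷ 1ℤ ∷ 0ℤ ∷ 0ℤ ∷ 0ℤ ∷ 0ℤ ∷ []) ∷
   (0ℤ ∷ 0ℤ ∷ 1ℤ ∷ 1ℤ ∷ 0ℤ ∷ 0ℤ ∷ 1ℤ ∷ 1ℤ ∷ 0ℤ ∷ 0ℤ ∷ 0ℤ ∷ 0ℤ ∷ []) ∷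
   (0ℤ ∷ 1ℤ ∷ + 2 ∷ 0ℤ ∷ 0ℤ ∷ 1ℤ ∷ 0ℤ ∷ 0ℤ ∷ 0ℤ ∷ 1ℤ ∷ 0ℤ ∷ 0ℤ ∷ []) ∷
   (0ℤ ∷ 1ℤ ∷ + 2 ∷ 1ℤ ∷ 1ℤ ∷ 0ℤ ∷ 0ℤ ∷ 0ℤ ∷ 0ℤ ∷ 1ℤ ∷ 1ℤ ∷ 1ℤ ∷ []) ∷
   (0ℤ ∷ 1ℤ ∷ + 2 ∷ 0ℤ ∷ 0ℤ ∷ 0ℤ ∷ 0ℤ ∷ 0ℤ ∷ 0ℤ ∷ 1ℤ ∷ 0ℤ ∷ 0ℤ ∷ []) ∷
   (1ℤ ∷ 1ℤ ∷ 1ℤ ∷ 0ℤ ∷ 1ℤ ∷ 1ℤ ∷ 0ℤ ∷ 0ℤ ∷ 1ℤ ∷ 0ℤ ∷ 0ℤ ∷ 0ℤ ∷ []) ∷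
   (1ℤ ∷ 1ℤ ∷ + 2 ∷ 0ℤ ∷ 0ℤ ∷ 0ℤ ∷ 0ℤ ∷ 0ℤ ∷ 1ℤ ∷ 1ℤ ∷ 0ℤ ∷ 0ℤ ∷ []) ∷ [])

value-initial : ∀ i → + (if does (sameArcs? (arcs i) finished) then 1 else 0) ≡ dot (value i) (e 1F)
value-initial = toWitness {a? = Fin.all? λ i → _ ℤ.≟ dot (value i) (e 1F)} tt

value-step : ∀ i → Σᵥ (map (value ∘ index) (step (arcs i))) ≡ value i ⊡ transfer
value-step = toWitness {a? = Fin.all? λ i →
  Vec.≡-dec ℤ._≟_ (Σᵥ (map (value ∘ index) (step (arcs i)))) (value i ⊡ transfer)} tt

open Frontier arcs index table-closed
open Valuation value (e 1F) transfer value-initial value-step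

-- Tours as paths

place : ∀ {n} → Vertex 4 n → Node
place (r , c) = at r (toℕ c)

place-injective : ∀ {n} {u v : Vertex 4 n} → place u ≡ place v → u ≡ v
place-injective eq = cong₂ _,_ (proj₁ (at-injective eq)) (Fin.toℕ-injective (proj₂ (at-injective eq)))

withEnds : ∀ {n} → List (Vertex 4 n) → List Node
withEnds w = S ∷ (map place w ++ T ∷ [])

withEnds-injective : ∀ {n} {w w′ : List (Vertex 4 n)} → withEnds w ≡ withEnds w′ → w ≡ w′
withEnds-injective {w = w} {w′} eq = map-injective place-injective
  (∷ʳ-injectiveˡ (map place w) (map place w′) (∷-injectiveʳ eq))

∉-map-place : ∀ {n x} (w : List (Vertex 4 n)) → (∀ {r c} → x ≢ at r c) → x ∉ map place w
∉-map-place w x≢ x∈ = let _ , _ , eq = ∈-map⁻ place x∈ in x≢ eq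

next-++⁻ : ∀ {z : A} l {x y} → Next (l ++ z ∷ []) x y → Next l x y ⊎ (x ∈ l × y ≡ z)
next-++⁻ [] (there ())
next-++⁻ (_ ∷ []) here = inj₂ (here refl , refl)
next-++⁻ (_ ∷ _ ∷ _) here = inj₁ here
next-++⁻ (_ ∷ l) (there n) with next-++⁻ l n
... | inj₁ n′       = inj₁ (there n′)
... | inj₂ (x∈ , e) = inj₂ (there x∈ , e)

next-++⁺ : ∀ {l m : List A} {x y} → Next l x y → Next (l ++ m) x y
next-++⁺ here = here
next-++⁺ (there n) = there (next-++⁺ n)

linked⁺ : ∀ {R : A → A → Set} l → (∀ {x y} → Next l x y → R x y) → Linked R l
linked⁺ [] r = []
linked⁺ (_ ∷ []) r = [-]
linked⁺ (_ ∷ l@(_ ∷ _)) r = r here ∷ linked⁺ l (r ∘ there)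

linked⁻ : ∀ {R : A → A → Set} {l x y} → Linked R l → Next l x y → R x y
linked⁻ (r ∷ _) here = r
linked⁻ (_ ∷ rs) (there n) = linked⁻ rs n

tour⇒path : ∀ {n} {w : List (Vertex 4 n)} → IsTour w → Path started (cells n) (withEnds w)
tour⇒path {w = []} (isTour () _ _ _)
tour⇒path {n} {w@(v ∷ _)} t = record
  { unique = ∉⇒Unique
      (λ S∈ → case ∈-++⁻ (map place w) S∈ of λ where
        (inj₁ S∈w) → ∉-map-place w (λ ()) S∈w
        (inj₂ (here ()))
        (inj₂ (there ())))
      (Unique.++⁺ (Unique.map⁺ place-injective avoiding) ([] ∷ [])
        λ { (x∈ , here refl) → ∉-map-place w (λ ()) x∈ ; (_ , there ()) })
  ; visits = mk⇔ visit⁺ visit⁻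
  ; from-S = λ m → case ∈-++⁻ (map place w) (next-target m) of λ where
      (inj₁ S∈) → ∉-map-place w (λ ()) S∈
      (inj₂ (here ()))
      (inj₂ (there ()))
  ; to-T = λ m → case next-++⁻ (S ∷ map place w) m of λ where
      (inj₁ m′) → T∉ (next-source m′)
      (inj₂ (T∈ , _)) → T∉ T∈
  ; steps = λ where
      here → inj₂ (here (cong (S ,_) head≡))
      (there m) → inj₁ (edge m)
  ; required = λ { (here refl) → subst (Next (withEnds w) S) head≡ here ; (there ()) }
  }
  where
  open IsTour t

  T∉ : T ∉ S ∷ map place w
  T∉ (there T∈) = ∉-map-place w (λ ()) T∈

  edge : ∀ {x y} → Next (map place w ++ T ∷ []) x y → Edge x y
  edge m with next-++⁻ (map place w) m
  ... | inj₁ m′ with _ , _ , m″ , refl , refl ← next-map⁻ place m′ = linked⁻ walk m″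
  ... | inj₂ (x∈ , refl) with _ , _ , refl ← ∈-map⁻ place x∈ = tt

  head≡ : place v ≡ r₀
  head≡ = cong₂ at (Fin.toℕ-injective (proj₁ start)) (proj₂ start)

  visit⁺ : ∀ {x} → x ∈ withEnds w → x ∈ S ∷ T ∷ cells n
  visit⁺ (here refl) = here refl
  visit⁺ (there x∈) with ∈-++⁻ (map place w) x∈
  ... | inj₂ (here refl) = there (here refl)
  ... | inj₁ x∈w with (r , c) , _ , refl ← ∈-map⁻ place x∈w = there (there (∈-cells⁺ r (Fin.toℕ<n c)))

  visit⁻ : ∀ {x} → x ∈ S ∷ T ∷ cells n → x ∈ withEnds w
  visit⁻ (here refl) = here refl
  visit⁻ (there (here refl)) = there (∈-++⁺ʳ (map place w) (here refl))
  visit⁻ (there (there x∈)) with r , c , refl ← cells-at n x∈ =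
    there (∈-++⁺ˡ (subst (λ c → at r c ∈ map place w) (Fin.toℕ-fromℕ< c<n)
      (∈-map⁺ place (covering r (Fin.fromℕ< c<n)))))
    where
    c<n : c ℕ.< n
    c<n = ∈-cells⁻ n x∈

headed : ∀ {l : List A} {x} → x ∈ l → (∀ {y} → ¬ Next l y x) → ∃ λ m → l ≡ x ∷ m
headed (here refl) _ = _ , refl
headed {l = _ ∷ _} (there x∈) none = contradiction (proj₂ (predecessor-in-tail x∈)) none

ended : ∀ {l : List A} {x} → x ∈ l → (∀ {y} → ¬ Next l x y) → ∃ λ m → l ≡ m ++ x ∷ []
ended {l = _ ∷ []} (here refl) _ = [] , refl
ended {l = _ ∷ _ ∷ _} (here refl) none = contradiction here none
ended {l = y ∷ _} (there x∈) none with m , refl ← ended x∈ (none ∘ there) = y ∷ m , refl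

placed : ∀ {n} l → (∀ {x} → x ∈ l → x ∈ cells n) → ∃ λ (w : List (Vertex 4 n)) → l ≡ map place w
placed [] _ = [] , refl
placed {n} (x ∷ l) all
  with r , c , refl ← cells-at n (all (here refl)) | w , eq ← placed {n} l (all ∘ there) =
  (r , Fin.fromℕ< c<n) ∷ w , cong₂ (λ c l → at r c ∷ l) (sym (Fin.toℕ-fromℕ< c<n)) eq
  where
  c<n : c ℕ.< n
  c<n = ∈-cells⁻ n (all (here refl))

withEnds-path⇒tour : ∀ {n} {w : List (Vertex 4 n)} → Path started (cells n) (withEnds w) → IsTour w
withEnds-path⇒tour {n} {w} π = record
  { start = starts w unique (required (here refl))
  ; walk = linked⁺ w λ m → case steps (there (next-++⁺ (next-map⁺ place m))) of λ where
      (inj₁ edge) → edge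
      (inj₂ (here ()))
      (inj₂ (there ()))
  ; avoiding = Unique.map⁻ (Unique-tail (Unique-resp-↭ (++-comm (map place w) _) (Unique-tail unique)))
  ; covering = covers
  }
  where
  open Path π

  starts : ∀ (w : List (Vertex 4 n)) → Unique (withEnds w) → Next (withEnds w) S r₀ → StartsUpperLeft w
  starts [] u m = case next-functional u here m of λ ()
  starts (_ ∷ _) u m = let r≡ , c≡ = at-injective (next-functional u here m) in cong toℕ r≡ , c≡

  covers : VisitsAll w
  covers r c with from visits (there (there (∈-cells⁺ r (Fin.toℕ<n c))))
  ... | there x∈ with ∈-++⁻ (map place w) x∈
  ...   | inj₂ (here ())
  ...   | inj₂ (there ())
  ...   | inj₁ y∈ with _ , v∈ , eq ← ∈-map⁻ place y∈ = subst (_∈ w) (sym (place-injective eq)) v∈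

path-inner : ∀ {n a m} → Path a (cells n) (S ∷ (m ++ T ∷ [])) → ∀ {x} → x ∈ m → x ∈ cells n
path-inner {m = m} π x∈ with to (Path.visits π) (there (∈-++⁺ˡ x∈))
... | here refl = contradiction (∈-++⁺ˡ x∈) (∉-head (Path.unique π))
... | there (here refl) = contradiction x∈
  (∉-head (Unique-resp-↭ (++-comm m _) (Unique-tail (Path.unique π))))
... | there (there x∈′) = x∈′

path⇒withEnds : ∀ {n l} → Path started (cells n) l → ∃ λ (w : List (Vertex 4 n)) → l ≡ withEnds w
path⇒withEnds {n} π
  with l , refl ← headed (from (Path.visits π) (here refl)) (Path.from-S π)
  with from (Path.visits π) (there (here refl))
... | there T∈ with m , refl ← ended T∈ (Path.to-T π ∘ there)
  with w , eq ← placed {n} m (path-inner {n} π) = w , cong (λ l → S ∷ (l ++ T ∷ [])) eq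

-- Restricted to at least one column: on none, `walks` gives 0, as `r₀` is missing, whereas `g` is 1
-- by convention.
g-walks : ∀ n → g 4 (suc n) ≡ walks (suc n) 0F
g-walks n = count-unique
  (count-cong
    (mk⇔ (λ { (w , t , refl) → tour⇒path t })
         (λ π → let w , eq = path⇒withEnds π in w , withEnds-path⇒tour (subst (Path started _) eq π) , eq))
    (count-image withEnds (λ _ _ → withEnds-injective)
      (tours 4 (suc n) , tours-unique 4 (suc n) , ∈-tours , refl)))
  (count-walks (suc n) 0F)

-- Quotients of power series

-- The sum unfolds by computation at `F 0`; the recurrence needs the opposite end, where `F` has its
-- largest index.
⊛-shiftʳ : ∀ F Q n → (F ⊛ Q) (suc n) ≡ (F ⊛ (Q ∘ suc)) n ℤ.+ F (suc n) ℤ.* Q 0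
⊛-shiftʳ F Q zero = trans
  (cong (λ z → F 0 ℤ.* Q 1 ℤ.+ z) (ℤ.+-identityʳ (F 1 ℤ.* Q 0)))
  (cong (λ z → z ℤ.+ F 1 ℤ.* Q 0) (sym (ℤ.+-identityʳ (F 0 ℤ.* Q 1))))
⊛-shiftʳ F Q (suc n) = trans
  (cong (λ z → F 0 ℤ.* Q (suc (suc n)) ℤ.+ z) (⊛-shiftʳ (F ∘ suc) Q n))
  (sym (ℤ.+-assoc (F 0 ℤ.* Q (suc (suc n))) _ _))

⊛-zeroʳ : ∀ F {Q} → (∀ n → Q n ≡ 0ℤ) → ∀ n → (F ⊛ Q) n ≡ 0ℤ
⊛-zeroʳ F Q≡0 zero    = trans (ℤ.+-identityʳ _) (trans (cong (F 0 ℤ.*_) (Q≡0 0)) (ℤ.*-zeroʳ (F 0)))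
⊛-zeroʳ F Q≡0 (suc n) = cong₂ ℤ._+_
  (trans (cong (F 0 ℤ.*_) (Q≡0 (suc n))) (ℤ.*-zeroʳ (F 0)))
  (⊛-zeroʳ (F ∘ suc) Q≡0 n)

module Recurrence {k : ℕ} (u : Vec ℤ k) (M : Vec (Vec ℤ k) k) where

  orbit : ℕ → Vec ℤ k
  orbit zero    = u
  orbit (suc j) = orbit j ⊡ M

  -- The sum of Q (d - i) u M^i over i ≤ d: the reversed polynomial of `Q`, cut off at degree `d`,
  -- evaluated at `M` and applied to `u`.
  window : ℕ → PowerSeries → Vec ℤ k
  window zero    Q = Q 0 · u
  window (suc d) Q = window d (Q ∘ suc) ⊕ Q 0 · orbit (suc d)

  orbit-term : ∀ (F Q : PowerSeries) j n v → (∀ j → F (j ℕ.+ suc n) ≡ dot (orbit j) v) →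
               F (j ℕ.+ suc n) ℤ.* Q 0 ≡ dot (Q 0 · orbit j) v
  orbit-term F Q j n v F≡ = trans (cong (ℤ._* Q 0) (F≡ j))
    (trans (ℤ.*-comm (dot (orbit j) v) (Q 0)) (sym (dot-· (Q 0) (orbit j) v)))

  -- In the convolution, the terms with index of `F` above `n` are linear in `v` through the orbit
  -- and form the window; the others meet `Q` only above `d`.
  ⊛-window : ∀ F Q d n v → (∀ j → F (j ℕ.+ suc n) ≡ dot (orbit j) v) →
             (F ⊛ Q) (d ℕ.+ suc n) ≡ (F ⊛ (Q ∘ (d ℕ.+_) ∘ suc)) n ℤ.+ dot (window d Q) v
  ⊛-window F Q zero n v F≡ = trans (⊛-shiftʳ F Q n)
    (cong (λ z → (F ⊛ (Q ∘ suc)) n ℤ.+ z) (orbit-term F Q 0 n v F≡))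
  ⊛-window F Q (suc d) n v F≡ = begin
    (F ⊛ Q) (suc d ℕ.+ suc n)
      ≡⟨ ⊛-shiftʳ F Q (d ℕ.+ suc n) ⟩
    (F ⊛ (Q ∘ suc)) (d ℕ.+ suc n) ℤ.+ F (suc d ℕ.+ suc n) ℤ.* Q 0
      ≡⟨ cong₂ ℤ._+_ (⊛-window F (Q ∘ suc) d n v F≡) (orbit-term F Q (suc d) n v F≡) ⟩
    rest ℤ.+ dot earlier v ℤ.+ dot latest v
      ≡⟨ ℤ.+-assoc rest (dot earlier v) (dot latest v) ⟩
    rest ℤ.+ (dot earlier v ℤ.+ dot latest v)
      ≡⟨ cong (λ z → rest ℤ.+ z) (sym (dot-⊕ earlier latest v)) ⟩
    rest ℤ.+ dot (earlier ⊕ latest) v ∎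
    where
    open ≡-Reasoning

    rest : ℤ
    rest = (F ⊛ (Q ∘ (suc d ℕ.+_) ∘ suc)) n

    earlier latest : Vec ℤ k
    earlier = window d (Q ∘ suc)
    latest  = Q 0 · orbit (suc d)

  ⊛-vanishes : ∀ F Q d → True (Vec.≡-dec ℤ._≟_ (window d Q) zeros) → (∀ n → Q (suc d ℕ.+ n) ≡ 0ℤ) →
               ∀ n v → (∀ j → F (j ℕ.+ suc n) ≡ dot (orbit j) v) → (F ⊛ Q) (d ℕ.+ suc n) ≡ 0ℤ
  ⊛-vanishes F Q d window-zero Q≡0 n v F≡ = trans (⊛-window F Q d n v F≡)
    (cong₂ ℤ._+_ (⊛-zeroʳ F (λ m → trans (cong Q (ℕ.+-suc d m)) (Q≡0 m)) n)
                 (trans (cong (λ u → dot u v) (toWitness window-zero)) (dot-zeros v)))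

⊛-zeroˡ : ∀ Q n → (poly [] ⊛ Q) n ≡ 0ℤ
⊛-zeroˡ Q zero    = trans (ℤ.+-identityʳ _) (ℤ.*-zeroˡ (Q 0))
⊛-zeroˡ Q (suc n) = cong₂ ℤ._+_ (ℤ.*-zeroˡ (Q (suc n))) (⊛-zeroˡ Q n)

poly-⊛-vanishes : ∀ as {Q d} → (∀ n → d ℕ.≤ n → Q n ≡ 0ℤ) →
                  ∀ n → d ℕ.≤ n → (poly as ⊛ Q) (length as ℕ.+ n) ≡ 0ℤ
poly-⊛-vanishes []       {Q} Q≡0 n d≤n = ⊛-zeroˡ Q n
poly-⊛-vanishes (a ∷ as)     Q≡0 n d≤n = cong₂ ℤ._+_
  (trans (cong (a ℤ.*_) (Q≡0 _ (ℕ.m≤n⇒m≤1+n (ℕ.≤-trans d≤n (ℕ.m≤n+m n (length as)))))) (ℤ.*-zeroʳ a))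
  (poly-⊛-vanishes as Q≡0 n d≤n)

poly-vanishes : ∀ as n → length as ℕ.≤ n → poly as n ≡ 0ℤ
poly-vanishes []       n       _              = refl
poly-vanishes (_ ∷ as) (suc n) (ℕ.s≤s len≤n) = poly-vanishes as n len≤n

-- The numerator and the denominator

factor₁ factor₂ : List ℤ
factor₁ = + 1 ∷ - + 1 ∷ - + 3 ∷ - + 1 ∷ + 1 ∷ []
factor₂ = + 1 ∷ - + 2 ∷ - + 2 ∷ + 2 ∷ - + 1 ∷ []

numerator denominator : PowerSeries
numerator   = poly (+ 1 ∷ - + 2 ∷ - + 2 ∷ + 11 ∷ + 4 ∷ - + 10 ∷ + 4 ∷ + 2 ∷ - + 3 ∷ + 1 ∷ [])
denominator = poly factor₁ ⊛ poly factor₂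

denominator-vanishes : ∀ n → denominator (10 ℕ.+ n) ≡ 0ℤ
denominator-vanishes n =
  -- The two lengths add up to 10, one more than the degree 8 would require, and just what a window
  -- at 9 asks for.
  poly-⊛-vanishes factor₁ (poly-vanishes factor₂) (5 ℕ.+ n) (ℕ.m≤m+n 5 n)

-- The series follows the matrix only from `n = 1` on, so the orbit begins one transfer step after
-- the starting state.
firstRow : Value
firstRow = e 0F ⊡ transfer

open Recurrence firstRow transfer

tourSeries : PowerSeries
tourSeries zero    = 1ℤ
tourSeries (suc n) = dot firstRow (basis n)

G≗tourSeries : G 4 ≗ tourSeries
G≗tourSeries zero    = refl
G≗tourSeries (suc n) = trans (cong +_ (g-walks n))
  (trans (walks-value (suc n) 0F) (sym (dot-⊡ (e 0F) transfer (basis n))))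

tourSeries-orbit : ∀ n j → tourSeries (j ℕ.+ suc n) ≡ dot (orbit j) (basis n)
tourSeries-orbit n zero    = refl
tourSeries-orbit n (suc j) = trans
  (cong (tourSeries ∘ suc) (ℕ.+-suc j n))
  (trans (cong tourSeries (sym (trans (ℕ.+-suc j (suc n)) (cong suc (ℕ.+-suc j n)))))
  (trans (tourSeries-orbit (suc n) j) (sym (dot-⊡ (orbit j) transfer (basis n)))))

tourSeries-⊛-denominator : tourSeries ⊛ denominator ≗ numerator
tourSeries-⊛-denominator 0 = refl
tourSeries-⊛-denominator 1 = refl
tourSeries-⊛-denominator 2 = refl
tourSeries-⊛-denominator 3 = refl
tourSeries-⊛-denominator 4 = refl
tourSeries-⊛-denominator 5 = refl
tourSeries-⊛-denominator 6 = refl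
tourSeries-⊛-denominator 7 = refl
tourSeries-⊛-denominator 8 = refl
tourSeries-⊛-denominator 9 = refl
tourSeries-⊛-denominator (suc (suc (suc (suc (suc (suc (suc (suc (suc (suc n)))))))))) =
  -- The window at 8 is not zero, for it yields the coefficient 1 of x^9 in the numerator. The
  -- window at 9 is its product with `transfer` and vanishes, as `tt` verifies by evaluation; hence
  -- ten coefficients are computed separately.
  ⊛-vanishes tourSeries denominator 9 tt denominator-vanishes n (basis n) (tourSeries-orbit n)

mainTheorem9 : G 4 ≗ poly (+ 1 ∷ - + 2 ∷ - + 2 ∷ + 11 ∷ + 4 ∷ - + 10 ∷ + 4 ∷ + 2 ∷ - + 3 ∷ + 1 ∷ [])
    / poly (+ 1 ∷ - + 1 ∷ - + 3 ∷ - + 1 ∷ + 1 ∷ [])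
    ⊛ poly (+ 1 ∷ - + 2 ∷ - + 2 ∷ + 2 ∷ - + 1 ∷ [])
    ⟨ refl ⟩
mainTheorem9 n = trans (G≗tourSeries n) (/-unique tourSeries numerator denominator refl tourSeries-⊛-denominator n)
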